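{- Assume that $\epsilon\|\mathbf{A}\|_2^2\ge c_1\delta$ and $\epsilon\ge c_2/\sqrt d$, for fixed constants $c_1$ and $c_2$. Then any algorithm that selects rows in an online manner and outputs a spectral approximation to $\mathbf{A}^T\mathbf{A}$ with $(1+\epsilon)$ multiplicative error and $\delta$ additive error with probability at least $1/2$ must sample $$\Omega\left(\frac{d\log(\epsilon\|\mathbf{A}\|_2^2/\delta)}{\epsilon^2}\right)$$ rows of $\mathbf{A}$ in expectation.
   Context: $\mathbf{A}$ is a real $n\times d$ matrix and $\|\cdot\|_2$ is the spectral norm. A spectral approximation to $\mathbf{A}^T\mathbf{A}$ with $(1+\epsilon)$ multiplicative error and $\delta$ additive error is given by a matrix $\tilde{\mathbf{A}}$ with $(1-\epsilon)\mathbf{A}^T\mathbf{A}-\delta\mathbf{I}\preceq\tilde{\mathbf{A}}^T\tilde{\mathbf{A}}\preceq(1+\epsilon)\mathbf{A}^T\mathbf{A}+\delta\mathbf{I}$, where $\preceq$ is the Loewner (positive semidefinite) order and $\mathbf{I}$ is the $d\times d$ identity. An algorithm selects rows in an online manner if it reads the rows of $\mathbf{A}$ one by one and, upon seeing each row, immediately decides whether the (possibly rescaled) row is kept in the approximation $\tilde{\mathbf{A}}$ or discarded, without ever retracting these decisions.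
   Formalization: The formal theorem assumes ε ≤ ε₀ for an arbitrary ε₀ < 1, and the constants may depend on ε₀; without this the claim fails, since for ε ≥ 1, or when (1-ε)‖A‖₂² ≤ δ, keeping no rows is already a valid approximation. -}

module Defs where

open import Algebra.Bundles using (CommutativeRing; Semiring)
import Algebra.Definitions.RawSemiring as RawSemiringDefs
open import Data.Fin.Base using (Fin; toℕ)
import Data.Fin.Properties as Fin
open import Data.List.Base using (List; []; _∷_; length)
open import Data.Maybe.Base using (Maybe; just; nothing)
open import Data.Nat.Base as ℕ using (ℕ; zero; suc)
open import Data.Product.Base using (Σ-syntax; ∃-syntax; _×_)
open import Data.Vec.Functional using (Vector; head; tail; fromList)
open import Level using (0ℓ) renaming (suc to lsuc)
open import Relation.Binary.Core using (Rel)
import Relation.Binary.Construct.NonStrictToStrict as Strict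
open import Relation.Binary.PropositionalEquality.Core using (_≡_; _≢_)
open import Relation.Binary.Structures using (IsTotalOrder)
open import Relation.Nullary.Decidable.Core using (does)
open import Data.Bool.Base using (if_then_else_)
open import Relation.Nullary.Negation.Core using (¬_)
open import Relation.Unary using (Pred; Satisfiable; Empty; U; ∁; ⋃; _∩_; _≐_)

-- A Dedekind-complete ordered field, i.e. the real numbers (unique up to
-- isomorphism classically).  Inverse and supremum are total functions that
-- are only specified on nonzero arguments and on nonempty bounded sets.
record Reals : Set₁ where
  infix 4 _≤_
  infix 8 _⁻¹
  field
    commutativeRing : CommutativeRing 0ℓ 0ℓ

  open CommutativeRing commutativeRing public

  field
    _≤_          : Rel Carrier 0ℓ
    isTotalOrder : IsTotalOrder _≈_ _≤_
    +-monoˡ-≤    : ∀ {x y} z → x ≤ y → x + z ≤ y + z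
    *-nonneg     : ∀ {x y} → 0# ≤ x → 0# ≤ y → 0# ≤ x * y
    1≉0          : ¬ (1# ≈ 0#)
    _⁻¹          : Carrier → Carrier
    ⁻¹-cong      : ∀ {x y} → x ≈ y → x ⁻¹ ≈ y ⁻¹
    ⁻¹-inverseʳ  : ∀ {x} → ¬ (x ≈ 0#) → x * x ⁻¹ ≈ 1#

  IsUpperBound : Pred Carrier 0ℓ → Pred Carrier 0ℓ
  IsUpperBound S b = ∀ {x} → S x → x ≤ b

  IsSupremum : Pred Carrier 0ℓ → Pred Carrier 0ℓ
  IsSupremum S s = IsUpperBound S s × (∀ {b} → IsUpperBound S b → s ≤ b)

  field
    sup            : Pred Carrier 0ℓ → Carrier
    sup-isSupremum : ∀ S → Satisfiable S → Satisfiable (IsUpperBound S) →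
                     IsSupremum S (sup S)

module Analysis (𝓡 : Reals) where

  open Reals 𝓡 public
  open Strict _≈_ _≤_ public using (_<_)
  open RawSemiringDefs (Semiring.rawSemiring semiring) public
    using (_^_; sum) renaming (_×_ to _·ℕ_)

  ℝ : Set
  ℝ = Carrier

  infixl 7 _/_
  _/_ : ℝ → ℝ → ℝ
  x / y = x * y ⁻¹

  fromℕ : ℕ → ℝ
  fromℕ n = n ·ℕ 1#

  ½ : ℝ
  ½ = 1# / fromℕ 2

  -- The intended value for x ≥ 0.
  √ : ℝ → ℝ
  √ x = sup (λ y → y * y ≤ x)

  -- For x > 0, the supremum of the rationals (a - b)/q with 2^((a-b)/q) ≤ x.
  -- The base is immaterial in a bound up to constant factors.
  log₂ : ℝ → ℝ
  log₂ x = sup (λ y → ∃[ a ] ∃[ b ] ∃[ p ]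
    (fromℕ 2 ^ a ≤ fromℕ 2 ^ b * x ^ suc p) ×
    (y ≈ (fromℕ a - fromℕ b) / fromℕ (suc p)))

  Matrix : ℕ → ℕ → Set
  Matrix n d = Vector (Vector ℝ d) n

  infixl 7 _∙_
  _∙_ : ∀ {d} → Vector ℝ d → Vector ℝ d → ℝ
  x ∙ y = sum (λ i → x i * y i)

  _*ᵥ_ : ∀ {n d} → Matrix n d → Vector ℝ d → Vector ℝ n
  (A *ᵥ x) i = A i ∙ x

  ∥_∥ : ∀ {d} → Vector ℝ d → ℝ
  ∥ x ∥ = √ (x ∙ x)

  ∥_∥₂ : ∀ {n d} → Matrix n d → ℝ
  ∥ A ∥₂ = sup (λ r → ∃[ x ] (∥ x ∥ ≤ 1#) × (r ≈ ∥ A *ᵥ x ∥))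

  -- Aᵀ A
  gram : ∀ {n d} → Matrix n d → Matrix d d
  gram A i j = sum (λ k → A k i * A k j)

  𝐈 : ∀ {d} → Matrix d d
  𝐈 i j = if does (i Fin.≟ j) then 1# else 0#

  infixl 6 _⊕_ _⊖_
  infixl 7 _⊙_
  _⊕_ _⊖_ : ∀ {n d} → Matrix n d → Matrix n d → Matrix n d
  (A ⊕ B) i j = A i j + B i j
  (A ⊖ B) i j = A i j - B i j

  _⊙_ : ∀ {n d} → ℝ → Matrix n d → Matrix n d
  (c ⊙ A) i j = c * A i j

  -- Only used between symmetric matrices.
  infix 4 _≼_
  _≼_ : ∀ {d} → Matrix d d → Matrix d d → Set
  A ≼ B = ∀ x → 0# ≤ x ∙ ((B ⊖ A) *ᵥ x)

  IsSpectralApproximation : ∀ {n m d} → ℝ → ℝ → Matrix n d → Matrix m d → Set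
  IsSpectralApproximation ε δ A Ã =
    ((1# - ε) ⊙ gram A ⊖ δ ⊙ 𝐈 ≼ gram Ã) ×
    (gram Ã ≼ (1# + ε) ⊙ gram A ⊕ δ ⊙ 𝐈)

  -- A deterministic online algorithm, given the total number of rows, the
  -- previously read rows (most recent first) and the current row, either
  -- keeps the current row multiplied by a scalar or discards it.  Letting it
  -- know the number of rows in advance only enlarges the class of algorithms.
  OnlineAlgorithm : ℕ → Set
  OnlineAlgorithm d = ℕ → List (Vector ℝ d) → Vector ℝ d → Maybe ℝ

  keptRows : ∀ {n d} → (List (Vector ℝ d) → Vector ℝ d → Maybe ℝ) →
             List (Vector ℝ d) → Matrix n d → List (Vector ℝ d)
  keptRows {zero}  decide past A = []
  keptRows {suc n} decide past A with decide past (head A)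
  ... | just w  = (λ j → w * head A j) ∷ keptRows decide (head A ∷ past) (tail A)
  ... | nothing = keptRows decide (head A ∷ past) (tail A)

  run : ∀ {n d} → OnlineAlgorithm d → Matrix n d → List (Vector ℝ d)
  run {n} alg A = keptRows (alg n) [] A

  record ProbabilitySpace : Set (lsuc (lsuc 0ℓ)) where
    field
      Ω          : Set
      Event      : Pred (Pred Ω 0ℓ) (lsuc 0ℓ)
      Event-resp : ∀ {E F} → E ≐ F → Event E → Event F
      U-event    : Event U
      ∁-event    : ∀ {E} → Event E → Event (∁ E)
      ⋃-event    : ∀ (E : ℕ → Pred Ω 0ℓ) → (∀ i → Event (E i)) → Event (⋃ ℕ E)

      ℙ          : ∀ {E} → Event E → ℝ
      ℙ-cong     : ∀ {E F} → E ≐ F → (e : Event E) (f : Event F) → ℙ e ≈ ℙ f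
      ℙ-nonneg   : ∀ {E} (e : Event E) → 0# ≤ ℙ e
      ℙ-U        : ℙ U-event ≈ 1#
      -- As the terms are nonnegative, the sum of the series is the supremum
      -- of its partial sums.
      ℙ-σ-additive : ∀ (E : ℕ → Pred Ω 0ℓ) (e : ∀ i → Event (E i)) →
        (∀ {i j} → i ≢ j → Empty (E i ∩ E j)) →
        IsSupremum (λ s → ∃[ n ] s ≈ sum {n} (λ i → ℙ (e (toℕ i))))
                   (ℙ (⋃-event E e))

  -- A random choice of a deterministic online algorithm.  The only
  -- measurability imposed is that the number of kept rows is a random variable.
  record RandomizedOnlineAlgorithm (d : ℕ) : Set (lsuc (lsuc 0ℓ)) where
    field
      space : ProbabilitySpace

    open ProbabilitySpace space public

    field
      algorithm   : Ω → OnlineAlgorithm d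
      count-event : ∀ {n} (A : Matrix n d) k →
                    Event (λ ω → length (run (algorithm ω) A) ≡ k)

    -- At most n of n rows are kept, so the expectation is a finite sum.
    expectedRows : ∀ {n} → Matrix n d → ℝ
    expectedRows {n} A =
      sum {suc n} (λ k → fromℕ (toℕ k) * ℙ (count-event A (toℕ k)))

    SucceedsWithProbability≥½ : ∀ {n} → ℝ → ℝ → Matrix n d → Set₁
    SucceedsWithProbability≥½ ε δ A =
      Σ[ e ∈ Event (λ ω → IsSpectralApproximation ε δ A
                            (fromList (run (algorithm ω) A))) ]
        (½ ≤ ℙ e)

{-# OPTIONS --safe #-}
-- The hard matrix starts with the row s e₀, which already fixes the norm of every prefix, and
-- continues with L ≈ log(ε s²/δ) blocks on the remaining D = d - 1 coordinates.  Each block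
-- consists of the edge vectors e_a + e_b of a complete graph, scaled so that the Gram matrix of the
-- first ℓ blocks is S ℓ · K with S growing by a large constant factor Γ.
--
-- If the kept rows approximate two prefixes ℓ < ℓ′, then the Gram matrix M of the rows kept in
-- between equals (S ℓ′ - S ℓ) K up to an error of O(ε) S ℓ′ K.  For a vertex i let N be the set of its
-- neighbours among those rows.  The values of M at the test vectors τ e_i ± ε 1_N differ by at least
-- 4 τ ε M_ii, because every kept edge at i ends in N, whereas those of K differ by at most 8 τ ε |N|.
-- Hence N is large, and summing over i shows that Ω(D/ε²) rows are kept between the two prefixes.
--
-- Padding the prefixes with zero rows, the same decisions are made on all of them, so an outcome
-- in which j prefixes are well approximated keeps Ω(j D/ε²) rows.  In expectation at least half of
-- the L prefixes are well approximated.
module Submission where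

open import Defs
open import Axiom.ExcludedMiddle using (ExcludedMiddle)
open import Data.Nat.Base using (ℕ; NonZero)
open import Data.Product.Base using (∃-syntax; _×_)
open import Level using (0ℓ)

import Algebra.Properties.Ring as RingProperties
import Algebra.Properties.Semiring.Exp as Exp
import Algebra.Properties.Semiring.Mult as Multiples
import Algebra.Properties.Semiring.Sum as Summation
import Algebra.Solver.Ring as RingSolver
open import Algebra.Solver.Ring.AlmostCommutativeRing
  using (fromCommutativeRing; _-Raw-AlmostCommutative⟶_)
open import Data.Bool.Base as Bool using (true; false; if_then_else_)
open import Data.Fin.Base as Fin using (Fin; zero; suc; toℕ; combine; remQuot; splitAt; _↑ˡ_; _↑ʳ_)
import Data.Fin.Properties as Fin
open import Data.Integer.Base as ℤ using (ℤ; +_; -[1+_])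
import Data.Integer.Properties as ℤ
open import Data.List.Base using (List; []; _∷_; length)
open import Data.Maybe.Base using (Maybe; just; nothing)
open import Data.Nat.Base as ℕ using (zero; suc)
import Data.Nat.Properties as ℕ
open import Data.Product.Base using (Σ-syntax; _,_; proj₁; proj₂)
open import Data.Sum.Base using (_⊎_; inj₁; inj₂)
open import Data.Vec.Functional as Vector using (Vector; head; tail; fromList)
open import Function.Base using (_∘_)
open import Relation.Binary.Bundles using (Poset)
open import Relation.Binary.PropositionalEquality.Core as ≡ using (_≡_; _≢_)
import Relation.Binary.Reasoning.PartialOrder
import Relation.Binary.Reasoning.Setoid
open import Relation.Binary.Structures using (IsTotalOrder)
open import Relation.Nullary using (yes; no; ¬_; contradiction; does)
open import Relation.Unary using (Pred; ∅; ∁; ⋃; _∩_; Empty)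

-- Any single matrix has an approximation with O(d/ε²) rows, whatever its scales, so the logarithm
-- can only come from the ban on retracting: once the scale has grown by `Γ`, the rows kept so far
-- are a negligible share of the Gram matrix and the approximation has to be built anew. The length
-- ε of the perturbation by 1_N balances the estimate at a vertex. At scale T, M_ii is of order T D,
-- so the gain 4 τ ε M_ii is linear in ε, and the error ε T D (τ² + ε² |N|) carries the same factor
-- ε T D. A small constant τ thus forces ε² |N| to be bounded below. The contribution of K itself,
-- relative to the gain, is of order |N| / D, which is at most ε² |N| once D ε² ≥ 1; this is where ε
-- ≥ c₂/√d enters. The edge vectors are sums, not differences, so that K has nonnegative entries and
-- 1_N pairs with e_i with one sign. The row s e₀ is needed because success is assumed only for
-- matrices whose norm is large compared with δ; the early prefixes would otherwise be too small.

module LowerBound (em : ExcludedMiddle 0ℓ) (𝓡 : Reals) where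

  open Analysis 𝓡 hiding (zero)
  open Exp semiring using (^-homo-*; ^-assocʳ; ^-congˡ)
  open Multiples semiring using (×1-homo-*; ×-homo-+)
  open RingProperties ring using (-‿distribˡ-*; -‿distribʳ-*; -‿involutive; -‿+-comm; -0#≈0#)
  open Summation semiring
    using (sum-cong-≋; ∑-distrib-+; ∑-comm; *-distribˡ-sum; *-distribʳ-sum; sum-replicate-zero; sum-init-last)

  module ≈-Reasoning = Relation.Binary.Reasoning.Setoid setoid

  poset : Poset 0ℓ 0ℓ 0ℓ
  poset = record { isPartialOrder = IsTotalOrder.isPartialOrder isTotalOrder }

  open Poset poset using (≤-respˡ-≈; ≤-respʳ-≈)
    renaming (refl to ≤-refl; reflexive to ≤-reflexive; trans to ≤-trans; antisym to ≤-antisym)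

  ≤-total : ∀ x y → x ≤ y ⊎ y ≤ x
  ≤-total = IsTotalOrder.total isTotalOrder

  module ≤-Reasoning = Relation.Binary.Reasoning.PartialOrder poset

  -- Ring solver with integer coefficients

  -- The first two clauses make the images of the literals 0 and 1 exactly 0# and 1#.
  fromℤ : ℤ → ℝ
  fromℤ (+ 0)     = 0#
  fromℤ (+ 1)     = 1#
  fromℤ (+ n)     = fromℕ n
  fromℤ -[1+ n ]  = - fromℕ (suc n)

  fromℤ-+ : ∀ n → fromℤ (+ n) ≈ fromℕ n
  fromℤ-+ 0             = refl
  fromℤ-+ 1             = sym (+-identityʳ 1#)
  fromℤ-+ (suc (suc n)) = refl

  fromℤ-neg : ∀ i → fromℤ (ℤ.- i) ≈ - fromℤ i
  fromℤ-neg (+ 0)     = sym -0#≈0#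
  fromℤ-neg (+ 1)     = -‿cong (+-identityʳ 1#)
  fromℤ-neg (+ suc (suc n)) = refl
  fromℤ-neg -[1+ n ]  = trans (fromℤ-+ (suc n)) (sym (-‿involutive _))

  fromℤ-⊖ : ∀ m n → fromℤ (m ℤ.⊖ n) ≈ fromℕ m - fromℕ n
  fromℤ-⊖ m       zero    = trans (fromℤ-+ m) (sym (trans (+-congˡ -0#≈0#) (+-identityʳ _)))
  fromℤ-⊖ zero    (suc n) = sym (+-identityˡ _)
  fromℤ-⊖ (suc m) (suc n) = begin
    fromℤ (suc m ℤ.⊖ suc n)                ≡⟨ ≡.cong fromℤ (ℤ.[1+m]⊖[1+n]≡m⊖n m n) ⟩
    fromℤ (m ℤ.⊖ n)                        ≈⟨ fromℤ-⊖ m n ⟩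
    fromℕ m - fromℕ n                      ≈⟨ +-congʳ (+-identityˡ _) ⟨
    0# + fromℕ m - fromℕ n                 ≈⟨ +-congʳ (+-congʳ (-‿inverseʳ 1#)) ⟨
    1# - 1# + fromℕ m - fromℕ n            ≈⟨ +-congʳ (+-assoc _ _ _) ⟩
    1# + (- 1# + fromℕ m) - fromℕ n        ≈⟨ +-congʳ (+-congˡ (+-comm _ _)) ⟩
    1# + (fromℕ m - 1#) - fromℕ n          ≈⟨ +-congʳ (+-assoc _ _ _) ⟨
    1# + fromℕ m - 1# - fromℕ n            ≈⟨ +-assoc _ _ _ ⟩
    1# + fromℕ m + (- 1# - fromℕ n)        ≈⟨ +-congˡ (-‿+-comm _ _) ⟩
    fromℕ (suc m) - fromℕ (suc n)          ∎
    where open ≈-Reasoning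

  fromℤ-homo-+ : ∀ i j → fromℤ (i ℤ.+ j) ≈ fromℤ i + fromℤ j
  fromℤ-homo-+ (+ m) (+ n) = trans (fromℤ-+ (m ℕ.+ n)) (trans (×-homo-+ 1# m n)
    (sym (+-cong (fromℤ-+ m) (fromℤ-+ n))))
  fromℤ-homo-+ (+ m) -[1+ n ] = trans (fromℤ-⊖ m (suc n)) (+-congʳ (sym (fromℤ-+ m)))
  fromℤ-homo-+ -[1+ m ] (+ n) = trans (fromℤ-⊖ n (suc m))
    (trans (+-comm _ _) (+-congˡ (sym (fromℤ-+ n))))
  fromℤ-homo-+ -[1+ m ] -[1+ n ] = begin
    - fromℕ (suc (suc (m ℕ.+ n)))       ≡⟨ ≡.cong (λ k → - fromℕ (suc k)) (ℕ.+-suc m n) ⟨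
    - fromℕ (suc m ℕ.+ suc n)           ≈⟨ -‿cong (×-homo-+ 1# (suc m) (suc n)) ⟩
    - (fromℕ (suc m) + fromℕ (suc n))   ≈⟨ -‿+-comm _ _ ⟨
    - fromℕ (suc m) - fromℕ (suc n)     ∎
    where open ≈-Reasoning

  fromℤ-homo-*-+ : ∀ m j → fromℤ (+ m ℤ.* j) ≈ fromℕ m * fromℤ j
  fromℤ-homo-*-+ m (+ n) = begin
    fromℤ (+ m ℤ.* + n)   ≡⟨ ≡.cong fromℤ (ℤ.pos-* m n) ⟨
    fromℤ (+ (m ℕ.* n))   ≈⟨ fromℤ-+ (m ℕ.* n) ⟩
    fromℕ (m ℕ.* n)       ≈⟨ ×1-homo-* m n ⟩
    fromℕ m * fromℕ n     ≈⟨ *-congˡ (fromℤ-+ n) ⟨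
    fromℕ m * fromℤ (+ n) ∎
    where open ≈-Reasoning
  fromℤ-homo-*-+ m -[1+ n ] = begin
    fromℤ (+ m ℤ.* -[1+ n ])         ≡⟨ ≡.cong fromℤ (ℤ.neg-distribʳ-* (+ m) (+ suc n)) ⟨
    fromℤ (ℤ.- (+ m ℤ.* + suc n))    ≈⟨ fromℤ-neg (+ m ℤ.* + suc n) ⟩
    - fromℤ (+ m ℤ.* + suc n)        ≈⟨ -‿cong (fromℤ-homo-*-+ m (+ suc n)) ⟩
    - (fromℕ m * fromℤ (+ suc n))    ≈⟨ -‿cong (*-congˡ (fromℤ-+ (suc n))) ⟩
    - (fromℕ m * fromℕ (suc n))      ≈⟨ -‿distribʳ-* _ _ ⟩
    fromℕ m * - fromℕ (suc n)        ∎
    where open ≈-Reasoning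

  fromℤ-homo-* : ∀ i j → fromℤ (i ℤ.* j) ≈ fromℤ i * fromℤ j
  fromℤ-homo-* (+ m) j = trans (fromℤ-homo-*-+ m j) (*-congʳ (sym (fromℤ-+ m)))
  fromℤ-homo-* -[1+ m ] j = begin
    fromℤ (-[1+ m ] ℤ.* j)          ≡⟨ ≡.cong fromℤ (ℤ.neg-distribˡ-* (+ suc m) j) ⟨
    fromℤ (ℤ.- (+ suc m ℤ.* j))     ≈⟨ fromℤ-neg (+ suc m ℤ.* j) ⟩
    - fromℤ (+ suc m ℤ.* j)         ≈⟨ -‿cong (fromℤ-homo-*-+ (suc m) j) ⟩
    - (fromℕ (suc m) * fromℤ j)     ≈⟨ -‿distribˡ-* _ _ ⟩
    - fromℕ (suc m) * fromℤ j       ∎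
    where open ≈-Reasoning

  morphism : ℤ.+-*-rawRing -Raw-AlmostCommutative⟶ fromCommutativeRing commutativeRing
  morphism = record
    { ⟦_⟧    = fromℤ
    ; +-homo = fromℤ-homo-+
    ; *-homo = fromℤ-homo-*
    ; -‿homo = fromℤ-neg
    ; 0-homo = refl
    ; 1-homo = refl
    }

  fromℤ-≟ : ∀ i j → Maybe (fromℤ i ≈ fromℤ j)
  fromℤ-≟ i j with i ℤ.≟ j
  ... | yes i≡j = just (reflexive (≡.cong fromℤ i≡j))
  ... | no _    = nothing

  open RingSolver ℤ.+-*-rawRing (fromCommutativeRing commutativeRing) morphism fromℤ-≟
    using (solve; con; Polynomial; _:+_; _:*_; _:-_; :-_; _:=_)

  :0 :1 :2 : ∀ {n} → Polynomial n
  :0 = con (+ 0)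
  :1 = con (+ 1)
  :2 = con (+ 2)

  -- Ordered field arithmetic and finite sums

  -- The workhorse for inequalities: the slack `e` is written as a sum of products already known to
  -- be nonnegative, and the remaining identity is left to the ring solver.
  ≤-by : ∀ {x y e} → 0# ≤ e → y ≈ x + e → x ≤ y
  ≤-by {x} {y} {e} 0≤e y≈x+e = begin
    x       ≈⟨ +-identityˡ x ⟨
    0# + x  ≤⟨ +-monoˡ-≤ x 0≤e ⟩
    e + x   ≈⟨ trans (+-comm e x) (sym y≈x+e) ⟩
    y       ∎
    where open ≤-Reasoning

  x≤y⇒0≤y-x : ∀ {x y} → x ≤ y → 0# ≤ y - x
  x≤y⇒0≤y-x {x} {y} x≤y = ≤-respˡ-≈ (-‿inverseʳ x) (+-monoˡ-≤ (- x) x≤y)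

  0≤y-x⇒x≤y : ∀ {x y} → 0# ≤ y - x → x ≤ y
  0≤y-x⇒x≤y {x} {y} 0≤y-x = ≤-by 0≤y-x (solve 2 (λ x y → y := x :+ (y :- x)) refl x y)

  <⇒≤ : ∀ {x y} → x < y → x ≤ y
  <⇒≤ = proj₁

  ≤-<-trans : ∀ {x y z} → x ≤ y → y < z → x < z
  ≤-<-trans {x} {y} {z} x≤y y<z = begin-strict x ≤⟨ x≤y ⟩ y <⟨ y<z ⟩ z ∎
    where open ≤-Reasoning

  <-≤-trans : ∀ {x y z} → x < y → y ≤ z → x < z
  <-≤-trans {x} {y} {z} x<y y≤z = begin-strict x <⟨ x<y ⟩ y ≤⟨ y≤z ⟩ z ∎
    where open ≤-Reasoning

  <⇒≱ : ∀ {x y} → x < y → ¬ (y ≤ x)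
  <⇒≱ (x≤y , x≉y) y≤x = x≉y (≤-antisym x≤y y≤x)

  ≰⇒> : ∀ {x y} → ¬ (x ≤ y) → y < x
  ≰⇒> {x} {y} x≰y with ≤-total x y
  ... | inj₁ x≤y = contradiction x≤y x≰y
  ... | inj₂ y≤x = y≤x , λ y≈x → x≰y (≤-reflexive (sym y≈x))

  ≮⇒≥ : ∀ {x y} → ¬ (x < y) → y ≤ x
  ≮⇒≥ {x} {y} x≮y with em {y ≤ x}
  ... | yes y≤x = y≤x
  ... | no  y≰x = contradiction (≰⇒> y≰x) x≮y

  +-mono-≤ : ∀ {a b c d} → a ≤ b → c ≤ d → a + c ≤ b + d
  +-mono-≤ {a} {b} {c} {d} a≤b c≤d = begin
    a + c  ≤⟨ +-monoˡ-≤ c a≤b ⟩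
    b + c  ≈⟨ +-comm b c ⟩
    c + b  ≤⟨ +-monoˡ-≤ b c≤d ⟩
    d + b  ≈⟨ +-comm d b ⟩
    b + d  ∎
    where open ≤-Reasoning

  +-nonneg : ∀ {x y} → 0# ≤ x → 0# ≤ y → 0# ≤ x + y
  +-nonneg 0≤x 0≤y = ≤-respˡ-≈ (+-identityˡ 0#) (+-mono-≤ 0≤x 0≤y)

  *-monoʳ-≤ : ∀ {x y z} → 0# ≤ z → x ≤ y → z * x ≤ z * y
  *-monoʳ-≤ {x} {y} {z} 0≤z x≤y = ≤-by (*-nonneg 0≤z (x≤y⇒0≤y-x x≤y))
    (solve 3 (λ x y z → z :* y := z :* x :+ z :* (y :- x)) refl x y z)

  *-monoˡ-≤ : ∀ {x y z} → 0# ≤ z → x ≤ y → x * z ≤ y * z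
  *-monoˡ-≤ {x} {y} {z} 0≤z x≤y = ≤-by (*-nonneg (x≤y⇒0≤y-x x≤y) 0≤z)
    (solve 3 (λ x y z → y :* z := x :* z :+ (y :- x) :* z) refl x y z)

  *-mono-≤ : ∀ {a b c d} → 0# ≤ a → 0# ≤ d → a ≤ b → c ≤ d → a * c ≤ b * d
  *-mono-≤ 0≤a 0≤d a≤b c≤d = ≤-trans (*-monoʳ-≤ 0≤a c≤d) (*-monoˡ-≤ 0≤d a≤b)

  neg-mono-≤ : ∀ {x y} → x ≤ y → - y ≤ - x
  neg-mono-≤ {x} {y} x≤y = ≤-by (x≤y⇒0≤y-x x≤y) (solve 2 (λ x y → :- x := :- y :+ (y :- x)) refl x y)

  square-nonneg : ∀ x → 0# ≤ x * x
  square-nonneg x with ≤-total 0# x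
  ... | inj₁ 0≤x = *-nonneg 0≤x 0≤x
  ... | inj₂ x≤0 = ≤-respʳ-≈ (solve 1 (λ x → (:- x) :* (:- x) := x :* x) refl x) (*-nonneg 0≤-x 0≤-x)
    where
    0≤-x : 0# ≤ - x
    0≤-x = ≤-by (x≤y⇒0≤y-x x≤0) (solve 1 (λ x → :- x := :0 :+ (:0 :- x)) refl x)

  0≤1 : 0# ≤ 1#
  0≤1 = ≤-respʳ-≈ (*-identityˡ 1#) (square-nonneg 1#)

  0<1 : 0# < 1#
  0<1 = 0≤1 , λ 0≈1 → 1≉0 (sym 0≈1)

  fromℕ-nonneg : ∀ n → 0# ≤ fromℕ n
  fromℕ-nonneg zero    = ≤-refl
  fromℕ-nonneg (suc n) = +-nonneg 0≤1 (fromℕ-nonneg n)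

  fromℕ-mono : ∀ {m n} → m ℕ.≤ n → fromℕ m ≤ fromℕ n
  fromℕ-mono {n = n} ℕ.z≤n = fromℕ-nonneg n
  fromℕ-mono (ℕ.s≤s m≤n) = +-mono-≤ ≤-refl (fromℕ-mono m≤n)

  0<fromℕ[1+n] : ∀ n → 0# < fromℕ (suc n)
  0<fromℕ[1+n] n = <-≤-trans 0<1 (≤-by (fromℕ-nonneg n) refl)

  <⇒≉ : ∀ {x} → 0# < x → ¬ (x ≈ 0#)
  <⇒≉ (_ , 0≉x) x≈0 = 0≉x (sym x≈0)

  *-cancelˡ-≈0 : ∀ {x y} → ¬ (x ≈ 0#) → x * y ≈ 0# → y ≈ 0#
  *-cancelˡ-≈0 {x} {y} x≉0 xy≈0 = begin
    y                ≈⟨ *-identityˡ y ⟨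
    1# * y           ≈⟨ *-congʳ (⁻¹-inverseʳ x≉0) ⟨
    x * x ⁻¹ * y     ≈⟨ solve 3 (λ x i y → x :* i :* y := i :* (x :* y)) refl x (x ⁻¹) y ⟩
    x ⁻¹ * (x * y)   ≈⟨ *-congˡ xy≈0 ⟩
    x ⁻¹ * 0#        ≈⟨ zeroʳ _ ⟩
    0#               ∎
    where open ≈-Reasoning

  *-pos : ∀ {x y} → 0# < x → 0# < y → 0# < x * y
  *-pos (0≤x , 0≉x) (0≤y , 0≉y) = *-nonneg 0≤x 0≤y ,
    λ 0≈xy → 0≉y (sym (*-cancelˡ-≈0 (λ x≈0 → 0≉x (sym x≈0)) (sym 0≈xy)))

  *-cancelˡ-≤ : ∀ {x y z} → 0# < z → z * x ≤ z * y → x ≤ y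
  *-cancelˡ-≤ {x} {y} {z} 0<z zx≤zy = ≮⇒≥ λ (y≤x , y≉x) →
    let z[x-y]≈0 : z * (x - y) ≈ 0#
        z[x-y]≈0 = ≤-antisym
          (≤-by (x≤y⇒0≤y-x zx≤zy) (solve 3 (λ x y z → :0 := z :* (x :- y) :+ (z :* y :- z :* x)) refl x y z))
          (*-nonneg (<⇒≤ 0<z) (x≤y⇒0≤y-x y≤x))
        x-y≈0 = *-cancelˡ-≈0 (<⇒≉ 0<z) z[x-y]≈0
    in y≉x (trans (sym (+-identityʳ y)) (trans (+-congˡ (sym x-y≈0)) (solve 2 (λ x y → y :+ (x :- y) := x) refl x y)))

  ⁻¹-pos : ∀ {x} → 0# < x → 0# < x ⁻¹
  ⁻¹-pos {x} 0<x = 0≤x⁻¹ , λ 0≈x⁻¹ → 1≉0 (begin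
    1#        ≈⟨ ⁻¹-inverseʳ (<⇒≉ 0<x) ⟨
    x * x ⁻¹  ≈⟨ *-congˡ 0≈x⁻¹ ⟨
    x * 0#    ≈⟨ zeroʳ x ⟩
    0#        ∎)
    where
    open ≈-Reasoning
    0≤x⁻¹ : 0# ≤ x ⁻¹
    0≤x⁻¹ = *-cancelˡ-≤ 0<x (≤-respˡ-≈ (sym (zeroʳ x)) (≤-respʳ-≈ (sym (⁻¹-inverseʳ (<⇒≉ 0<x))) 0≤1))

  x/y*y≈x : ∀ x {y} → 0# < y → x / y * y ≈ x
  x/y*y≈x x {y} 0<y = begin
    x * y ⁻¹ * y    ≈⟨ solve 3 (λ x i y → x :* i :* y := x :* (y :* i)) refl x (y ⁻¹) y ⟩
    x * (y * y ⁻¹)  ≈⟨ *-congˡ (⁻¹-inverseʳ (<⇒≉ 0<y)) ⟩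
    x * 1#          ≈⟨ *-identityʳ x ⟩
    x               ∎
    where open ≈-Reasoning

  x≤z*y⇒x/y≤z : ∀ {x y z} → 0# < y → x ≤ z * y → x / y ≤ z
  x≤z*y⇒x/y≤z {x} {y} {z} 0<y x≤zy = *-cancelˡ-≤ 0<y (begin
    y * (x / y)  ≈⟨ *-comm _ _ ⟩
    x / y * y    ≈⟨ x/y*y≈x x 0<y ⟩
    x            ≤⟨ x≤zy ⟩
    z * y        ≈⟨ *-comm _ _ ⟩
    y * z        ∎)
    where open ≤-Reasoning

  square-cancel-≤ : ∀ {x y} → 0# ≤ y → x * x ≤ y * y → x ≤ y
  square-cancel-≤ {x} {y} 0≤y x²≤y² = ≮⇒≥ λ y<x →
    let 0<x = ≤-<-trans 0≤y y<x
        0<[x-y][x+y] : 0# < (x - y) * (x + y)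
        0<[x-y][x+y] = *-pos
          (x≤y⇒0≤y-x (<⇒≤ y<x) , λ 0≈x-y → proj₂ y<x (trans (sym (+-identityʳ y)) (trans (+-congˡ 0≈x-y) (solve 2 (λ x y → y :+ (x :- y) := x) refl x y))))
          (<-≤-trans 0<x (≤-by 0≤y refl))
    in <⇒≱ 0<[x-y][x+y] (≤-by (x≤y⇒0≤y-x x²≤y²)
         (solve 2 (λ x y → :0 := (x :- y) :* (x :+ y) :+ (y :* y :- x :* x)) refl x y))

  square-mono-≤ : ∀ {x y} → 0# ≤ x → x ≤ y → x * x ≤ y * y
  square-mono-≤ 0≤x x≤y = *-mono-≤ 0≤x (≤-trans 0≤x x≤y) x≤y x≤y

  sum-cong : ∀ {n} {f g : Vector ℝ n} → (∀ i → f i ≈ g i) → sum f ≈ sum g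
  sum-cong = sum-cong-≋

  sum-mono : ∀ {n} {f g : Vector ℝ n} → (∀ i → f i ≤ g i) → sum f ≤ sum g
  sum-mono {zero}  f≤g = ≤-refl
  sum-mono {suc n} f≤g = +-mono-≤ (f≤g zero) (sum-mono (λ i → f≤g (suc i)))

  sum-zero : ∀ {n} {f : Vector ℝ n} → (∀ i → f i ≈ 0#) → sum f ≈ 0#
  sum-zero {n} f≈0 = trans (sum-cong f≈0) (sum-replicate-zero n)

  sum-nonneg : ∀ {n} {f : Vector ℝ n} → (∀ i → 0# ≤ f i) → 0# ≤ sum f
  sum-nonneg {zero}  0≤f = ≤-refl
  sum-nonneg {suc n} 0≤f = +-nonneg (0≤f zero) (sum-nonneg (λ i → 0≤f (suc i)))

  term≤sum : ∀ {n} {f : Vector ℝ n} → (∀ i → 0# ≤ f i) → ∀ i → f i ≤ sum f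
  term≤sum {f = f} 0≤f zero    = ≤-by (sum-nonneg (λ i → 0≤f (suc i))) refl
  term≤sum {f = f} 0≤f (suc i) = ≤-trans (term≤sum (λ i → 0≤f (suc i)) i) (≤-by (0≤f zero) (+-comm _ _))

  sum-const : ∀ n x → sum {n} (λ _ → x) ≈ fromℕ n * x
  sum-const zero    x = sym (zeroˡ x)
  sum-const (suc n) x = trans (+-congˡ (sum-const n x))
    (solve 2 (λ x n → x :+ n :* x := (:1 :+ n) :* x) refl x (fromℕ n))

  *-distribˡ-∑ : ∀ {n} x (f : Vector ℝ n) → x * sum f ≈ sum (λ i → x * f i)
  *-distribˡ-∑ = *-distribˡ-sum

  *-distribʳ-∑ : ∀ {n} x (f : Vector ℝ n) → sum f * x ≈ sum (λ i → f i * x)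
  *-distribʳ-∑ = *-distribʳ-sum

  ∑-distrib-minus : ∀ {n} (f g : Vector ℝ n) → sum (λ i → f i - g i) ≈ sum f - sum g
  ∑-distrib-minus {n} f g = begin
    sum (λ i → f i - g i)               ≈⟨ sum-cong (λ i → solve 2 (λ x y → x :- y := x :+ (:- :1) :* y) refl (f i) (g i)) ⟩
    sum (λ i → f i + (- 1#) * g i)      ≈⟨ ∑-distrib-+ f _ ⟩
    sum f + sum (λ i → (- 1#) * g i)    ≈⟨ +-congˡ (*-distribˡ-∑ (- 1#) g) ⟨
    sum f + (- 1#) * sum g              ≈⟨ solve 2 (λ x y → x :+ (:- :1) :* y := x :- y) refl (sum f) (sum g) ⟩
    sum f - sum g                       ∎
    where open ≈-Reasoning

  sum-𝐈 : ∀ {n} (i : Fin n) (f : Vector ℝ n) → sum (λ j → 𝐈 i j * f j) ≈ f i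
  sum-𝐈 zero    f = trans (+-cong (*-identityˡ _) (sum-zero (λ j → zeroˡ (f (suc j))))) (+-identityʳ _)
  sum-𝐈 (suc i) f = trans (+-cong (zeroˡ _) (sum-𝐈 i (f ∘ suc))) (+-identityˡ _)

  𝐈-cases : ∀ {n} (i j : Fin n) → (i ≡ j × 𝐈 i j ≡ 1#) ⊎ 𝐈 i j ≡ 0#
  𝐈-cases zero    zero    = inj₁ (≡.refl , ≡.refl)
  𝐈-cases zero    (suc j) = inj₂ ≡.refl
  𝐈-cases (suc i) zero    = inj₂ ≡.refl
  𝐈-cases (suc i) (suc j) with 𝐈-cases i j
  ... | inj₁ (i≡j , e) = inj₁ (≡.cong suc i≡j , e)
  ... | inj₂ e         = inj₂ e

  -- Quadratic forms of weighted graphs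

  -- Excluded middle supplies the indicator of an arbitrary proposition; neighbourhoods, events and
  -- successes involve comparisons of reals and come with no decision procedure.
  𝟙 : Set → ℝ
  𝟙 P = if does (em {P = P}) then 1# else 0#

  𝟙-cases : ∀ P → (P × 𝟙 P ≡ 1#) ⊎ (¬ P × 𝟙 P ≡ 0#)
  𝟙-cases P with em {P = P}
  ... | yes p = inj₁ (p , ≡.refl)
  ... | no ¬p = inj₂ (¬p , ≡.refl)

  𝟙-true : ∀ {P} → P → 𝟙 P ≡ 1#
  𝟙-true {P} p with 𝟙-cases P
  ... | inj₁ (_ , e)  = e
  ... | inj₂ (¬p , _) = contradiction p ¬p

  𝟙-false : ∀ {P} → ¬ P → 𝟙 P ≡ 0#
  𝟙-false {P} ¬p with 𝟙-cases P
  ... | inj₁ (p , _) = contradiction p ¬p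
  ... | inj₂ (_ , e) = e

  𝟙-nonneg : ∀ P → 0# ≤ 𝟙 P
  𝟙-nonneg P with 𝟙-cases P
  ... | inj₁ (_ , e) rewrite e = 0≤1
  ... | inj₂ (_ , e) rewrite e = ≤-refl

  𝟙-idem : ∀ P → 𝟙 P * 𝟙 P ≈ 𝟙 P
  𝟙-idem P with 𝟙-cases P
  ... | inj₁ (_ , e) rewrite e = *-identityˡ 1#
  ... | inj₂ (_ , e) rewrite e = zeroˡ 0#

  -- Adjacency in the complete graph. Sums over ordered pairs count each edge twice, so `form χ`
  -- belongs to the matrix 2((D - 2) I + J), with J the all-ones matrix. Loops are left out because
  -- a kept loop would enlarge the diagonal entry at its vertex without producing a neighbour.
  χ : ∀ {D} → Fin D → Fin D → ℝ
  χ a b = 1# - 𝐈 a b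

  χ-cases : ∀ {D} (a b : Fin D) → χ a b ≈ 1# ⊎ χ a b ≈ 0#
  χ-cases a b with 𝐈-cases a b
  ... | inj₁ (_ , e) rewrite e = inj₂ (-‿inverseʳ 1#)
  ... | inj₂ e       rewrite e = inj₁ (solve 0 (:1 :- :0 := :1) refl)

  χ≤1 : ∀ {D} (a b : Fin D) → χ a b ≤ 1#
  χ≤1 a b with χ-cases a b
  ... | inj₁ e = ≤-reflexive e
  ... | inj₂ e = ≤-respˡ-≈ (sym e) 0≤1

  χ-idem : ∀ {D} (a b : Fin D) → χ a b * χ a b ≈ χ a b
  χ-idem a b with χ-cases a b
  ... | inj₁ e = trans (*-congʳ e) (*-identityˡ _)
  ... | inj₂ e = trans (trans (*-congʳ e) (zeroˡ _)) (sym e)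

  infixl 6 _+ᵥ_ _-ᵥ_
  infixr 7 _·ᵥ_

  _+ᵥ_ _-ᵥ_ : ∀ {D} → Vector ℝ D → Vector ℝ D → Vector ℝ D
  (x +ᵥ y) i = x i + y i
  (x -ᵥ y) i = x i - y i

  _·ᵥ_ : ∀ {D} → ℝ → Vector ℝ D → Vector ℝ D
  (c ·ᵥ x) i = c * x i

  ∑∑ : ∀ {D} → (Fin D → Fin D → ℝ) → ℝ
  ∑∑ f = sum (λ a → sum (λ b → f a b))

  ∑∑-cong : ∀ {D} {f g : Fin D → Fin D → ℝ} → (∀ a b → f a b ≈ g a b) → ∑∑ f ≈ ∑∑ g
  ∑∑-cong f≈g = sum-cong (λ a → sum-cong (f≈g a))

  ∑∑-mono : ∀ {D} {f g : Fin D → Fin D → ℝ} → (∀ a b → f a b ≤ g a b) → ∑∑ f ≤ ∑∑ g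
  ∑∑-mono f≤g = sum-mono (λ a → sum-mono (f≤g a))

  ∑∑-distrib-+ : ∀ {D} (f g : Fin D → Fin D → ℝ) → ∑∑ (λ a b → f a b + g a b) ≈ ∑∑ f + ∑∑ g
  ∑∑-distrib-+ f g = trans (sum-cong (λ a → ∑-distrib-+ (f a) (g a))) (∑-distrib-+ (λ a → sum (f a)) _)

  ∑∑-distrib-minus : ∀ {D} (f g : Fin D → Fin D → ℝ) → ∑∑ (λ a b → f a b - g a b) ≈ ∑∑ f - ∑∑ g
  ∑∑-distrib-minus f g = trans (sum-cong (λ a → ∑-distrib-minus (f a) (g a))) (∑-distrib-minus (λ a → sum (f a)) _)

  *-distribˡ-∑∑ : ∀ {D} x (f : Fin D → Fin D → ℝ) → x * ∑∑ f ≈ ∑∑ (λ a b → x * f a b)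
  *-distribˡ-∑∑ {D} x f = trans (*-distribˡ-∑ {D} x _) (sum-cong (λ a → *-distribˡ-∑ x (f a)))

  -- The bilinear form of 2(D I + J). Besides giving `form-χ`, it is applied to e_i and a vector
  -- vanishing at i, where the term with the factor D disappears.
  ∑∑-cross : ∀ {D} (x v : Vector ℝ D) →
    ∑∑ (λ a b → (x a + x b) * (v a + v b)) ≈ fromℕ 2 * (fromℕ D * (x ∙ v)) + fromℕ 2 * (sum x * sum v)
  ∑∑-cross {D} x v = begin
    ∑∑ (λ a b → (x a + x b) * (v a + v b))
      ≈⟨ sum-cong inner ⟩
    sum (λ a → fromℕ D * (x a * v a) + sum v * x a + (sum x * v a + x ∙ v))
      ≈⟨ ∑-distrib-+ _ (λ a → sum x * v a + x ∙ v) ⟩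
    sum (λ a → fromℕ D * (x a * v a) + sum v * x a) + sum (λ a → sum x * v a + x ∙ v)
      ≈⟨ +-cong (∑-distrib-+ (λ a → fromℕ D * (x a * v a)) (λ a → sum v * x a)) (∑-distrib-+ (λ a → sum x * v a) (λ _ → x ∙ v)) ⟩
    sum (λ a → fromℕ D * (x a * v a)) + sum (λ a → sum v * x a) + (sum (λ a → sum x * v a) + sum {D} (λ _ → x ∙ v))
      ≈⟨ +-cong (+-cong (sym (*-distribˡ-∑ {D} _ _)) (sym (*-distribˡ-∑ {D} _ _))) (+-cong (sym (*-distribˡ-∑ {D} _ _)) (sum-const D _)) ⟩
    fromℕ D * (x ∙ v) + sum v * sum x + (sum x * sum v + fromℕ D * (x ∙ v))
      ≈⟨ solve 3 (λ p X V → p :+ V :* X :+ (X :* V :+ p) := :2 :* p :+ :2 :* (X :* V)) refl (fromℕ D * (x ∙ v)) (sum x) (sum v) ⟩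
    fromℕ 2 * (fromℕ D * (x ∙ v)) + fromℕ 2 * (sum x * sum v) ∎
    where
    open ≈-Reasoning
    inner : ∀ a → sum (λ b → (x a + x b) * (v a + v b)) ≈ fromℕ D * (x a * v a) + sum v * x a + (sum x * v a + x ∙ v)
    inner a = begin
      sum (λ b → (x a + x b) * (v a + v b))
        ≈⟨ sum-cong (λ b → solve 4 (λ x y v w → (x :+ y) :* (v :+ w) := x :* v :+ x :* w :+ (v :* y :+ y :* w)) refl (x a) (x b) (v a) (v b)) ⟩
      sum (λ b → x a * v a + x a * v b + (v a * x b + x b * v b))
        ≈⟨ ∑-distrib-+ (λ b → x a * v a + x a * v b) (λ b → v a * x b + x b * v b) ⟩
      sum (λ b → x a * v a + x a * v b) + sum (λ b → v a * x b + x b * v b)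
        ≈⟨ +-cong (∑-distrib-+ (λ _ → x a * v a) (λ b → x a * v b)) (∑-distrib-+ (λ b → v a * x b) (λ b → x b * v b)) ⟩
      sum {D} (λ _ → x a * v a) + sum (λ b → x a * v b) + (sum (λ b → v a * x b) + x ∙ v)
        ≈⟨ +-cong (+-cong (sum-const D _) (trans (sym (*-distribˡ-∑ {D} _ _)) (*-comm _ _))) (+-congʳ (trans (sym (*-distribˡ-∑ {D} _ _)) (*-comm _ _))) ⟩
      fromℕ D * (x a * v a) + sum v * x a + (sum x * v a + x ∙ v) ∎

  -- The quadratic form of ∑ W a b (e_a + e_b)(e_a + e_b)ᵀ.
  form : ∀ {D} → (Fin D → Fin D → ℝ) → Vector ℝ D → ℝ
  form W y = ∑∑ (λ a b → W a b * ((y a + y b) * (y a + y b)))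

  -- Polarisation: `≼` compares quadratic forms only, and this is how it yields information on the
  -- entries that link a vertex to its neighbours.
  form-polar : ∀ {D} (W : Fin D → Fin D → ℝ) (p q : Vector ℝ D) →
    form W (p +ᵥ q) - form W (p -ᵥ q) ≈ fromℕ 4 * ∑∑ (λ a b → W a b * ((p a + p b) * (q a + q b)))
  form-polar {D} W p q = begin
    form W (p +ᵥ q) - form W (p -ᵥ q)
      ≈⟨ ∑∑-distrib-minus {D} _ _ ⟨
    ∑∑ (λ a b → W a b * ((p a + q a + (p b + q b)) * (p a + q a + (p b + q b)))
              - W a b * ((p a - q a + (p b - q b)) * (p a - q a + (p b - q b))))
      ≈⟨ ∑∑-cong (λ a b → solve 5 (λ w x y u v →
           w :* ((x :+ u :+ (y :+ v)) :* (x :+ u :+ (y :+ v))) :- w :* ((x :- u :+ (y :- v)) :* (x :- u :+ (y :- v)))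
           := con (+ 4) :* (w :* ((x :+ y) :* (u :+ v)))) refl (W a b) (p a) (p b) (q a) (q b)) ⟩
    ∑∑ (λ a b → fromℕ 4 * (W a b * ((p a + p b) * (q a + q b))))
      ≈⟨ *-distribˡ-∑∑ {D} _ _ ⟨
    fromℕ 4 * ∑∑ (λ a b → W a b * ((p a + p b) * (q a + q b))) ∎
    where open ≈-Reasoning

  -- Companion of `form-polar`: when the bounds at p + q and p - q are subtracted, the main terms
  -- subtract but the errors add.
  ∙-parallelogram : ∀ {D} (p q : Vector ℝ D) →
    (p +ᵥ q) ∙ (p +ᵥ q) + (p -ᵥ q) ∙ (p -ᵥ q) ≈ fromℕ 2 * (p ∙ p + q ∙ q)
  ∙-parallelogram {D} p q = begin
    (p +ᵥ q) ∙ (p +ᵥ q) + (p -ᵥ q) ∙ (p -ᵥ q)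
      ≈⟨ ∑-distrib-+ (λ a → (p a + q a) * (p a + q a)) _ ⟨
    sum (λ a → (p a + q a) * (p a + q a) + (p a - q a) * (p a - q a))
      ≈⟨ sum-cong (λ a → solve 2 (λ x u → (x :+ u) :* (x :+ u) :+ (x :- u) :* (x :- u) := :2 :* (x :* x :+ u :* u)) refl (p a) (q a)) ⟩
    sum (λ a → fromℕ 2 * (p a * p a + q a * q a))
      ≈⟨ *-distribˡ-∑ {D} _ _ ⟨
    fromℕ 2 * sum (λ a → p a * p a + q a * q a)
      ≈⟨ *-congˡ (∑-distrib-+ (λ a → p a * p a) _) ⟩
    fromℕ 2 * (p ∙ p + q ∙ q) ∎
    where open ≈-Reasoning

  ·ᵥ-∙ : ∀ {D} c (x : Vector ℝ D) → (c ·ᵥ x) ∙ (c ·ᵥ x) ≈ c * c * (x ∙ x)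
  ·ᵥ-∙ {D} c x = trans (sum-cong (λ i → solve 2 (λ c x → c :* x :* (c :* x) := c :* c :* (x :* x)) refl c (x i)))
    (sym (*-distribˡ-∑ {D} _ _))

  form-𝐈 : ∀ {D} (y : Vector ℝ D) → form 𝐈 y ≈ fromℕ 4 * (y ∙ y)
  form-𝐈 {D} y = begin
    form 𝐈 y
      ≈⟨ sum-cong (λ a → sum-𝐈 a (λ b → (y a + y b) * (y a + y b))) ⟩
    sum (λ a → (y a + y a) * (y a + y a))
      ≈⟨ sum-cong (λ a → solve 1 (λ x → (x :+ x) :* (x :+ x) := con (+ 4) :* (x :* x)) refl (y a)) ⟩
    sum (λ a → fromℕ 4 * (y a * y a))
      ≈⟨ *-distribˡ-∑ {D} _ _ ⟨
    fromℕ 4 * (y ∙ y) ∎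
    where open ≈-Reasoning

  form-χ : ∀ {D} (y : Vector ℝ D) →
    form χ y ≈ fromℕ 2 * (fromℕ D * (y ∙ y)) + fromℕ 2 * (sum y * sum y) - fromℕ 4 * (y ∙ y)
  form-χ {D} y = begin
    form χ y
      ≈⟨ ∑∑-cong (λ a b → solve 2 (λ i z → (:1 :- i) :* z := z :- i :* z) refl (𝐈 a b) ((y a + y b) * (y a + y b))) ⟩
    ∑∑ (λ a b → (y a + y b) * (y a + y b) - 𝐈 a b * ((y a + y b) * (y a + y b)))
      ≈⟨ ∑∑-distrib-minus {D} _ _ ⟩
    ∑∑ (λ a b → (y a + y b) * (y a + y b)) - form 𝐈 y
      ≈⟨ +-cong (∑∑-cross y y) (-‿cong (form-𝐈 y)) ⟩
    fromℕ 2 * (fromℕ D * (y ∙ y)) + fromℕ 2 * (sum y * sum y) - fromℕ 4 * (y ∙ y) ∎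
    where open ≈-Reasoning

  -- Term by term from `χ≤1` and (x + z)² ≤ 2 x² + 2 z²; the exact formula `form-χ` would call for
  -- Cauchy-Schwarz on the sum of the entries.
  form-χ≤ : ∀ {D} (y : Vector ℝ D) → form χ y ≤ fromℕ 4 * fromℕ D * (y ∙ y)
  form-χ≤ {D} y = begin
    form χ y
      ≤⟨ ∑∑-mono (λ a b → ≤-by (+-nonneg (*-nonneg (x≤y⇒0≤y-x (χ≤1 a b)) (square-nonneg (y a + y b))) (square-nonneg (y a - y b)))
           (solve 3 (λ c x z → :2 :* (x :* x) :+ :2 :* (z :* z) := c :* ((x :+ z) :* (x :+ z)) :+ ((:1 :- c) :* ((x :+ z) :* (x :+ z)) :+ (x :- z) :* (x :- z)))
             refl (χ a b) (y a) (y b))) ⟩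
    ∑∑ (λ a b → fromℕ 2 * (y a * y a) + fromℕ 2 * (y b * y b))
      ≈⟨ ∑∑-distrib-+ (λ a b → fromℕ 2 * (y a * y a)) (λ a b → fromℕ 2 * (y b * y b)) ⟩
    ∑∑ {D} (λ a b → fromℕ 2 * (y a * y a)) + ∑∑ {D} (λ a b → fromℕ 2 * (y b * y b))
      ≈⟨ +-cong (sum-cong {D} (λ a → sum-const D (fromℕ 2 * (y a * y a)))) (sum-const D (sum (λ b → fromℕ 2 * (y b * y b)))) ⟩
    sum (λ a → fromℕ D * (fromℕ 2 * (y a * y a))) + fromℕ D * sum (λ b → fromℕ 2 * (y b * y b))
      ≈⟨ +-cong (trans (sym (*-distribˡ-∑ {D} _ _)) (*-congˡ (sym (*-distribˡ-∑ {D} _ _)))) (*-congˡ (sym (*-distribˡ-∑ {D} _ _))) ⟩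
    fromℕ D * (fromℕ 2 * (y ∙ y)) + fromℕ D * (fromℕ 2 * (y ∙ y))
      ≈⟨ solve 2 (λ D n → D :* (:2 :* n) :+ D :* (:2 :* n) := con (+ 4) :* D :* n) refl (fromℕ D) (y ∙ y) ⟩
    fromℕ 4 * fromℕ D * (y ∙ y) ∎
    where open ≤-Reasoning

  sum-𝐈-row : ∀ {D} (i : Fin D) → sum (𝐈 i) ≈ 1#
  sum-𝐈-row i = trans (sum-cong (λ j → sym (*-identityʳ (𝐈 i j)))) (sum-𝐈 i (λ _ → 1#))

  𝐈-diag : ∀ {D} (i : Fin D) → 𝐈 i i ≡ 1#
  𝐈-diag zero    = ≡.refl
  𝐈-diag (suc i) = 𝐈-diag i

  𝐈-nonneg : ∀ {D} (i j : Fin D) → 0# ≤ 𝐈 i j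
  𝐈-nonneg i j with 𝐈-cases i j
  ... | inj₁ (_ , e) rewrite e = 0≤1
  ... | inj₂ e       rewrite e = ≤-refl

  𝐈-∙ : ∀ {D} (i : Fin D) → 𝐈 i ∙ 𝐈 i ≈ 1#
  𝐈-∙ i = trans (sum-𝐈 i (𝐈 i)) (reflexive (𝐈-diag i))

  form-χ-𝐈 : ∀ {D} (i : Fin D) → form χ (𝐈 i) ≈ fromℕ 2 * fromℕ D - fromℕ 2
  form-χ-𝐈 {D} i = begin
    form χ (𝐈 i)
      ≈⟨ form-χ (𝐈 i) ⟩
    fromℕ 2 * (fromℕ D * (𝐈 i ∙ 𝐈 i)) + fromℕ 2 * (sum (𝐈 i) * sum (𝐈 i)) - fromℕ 4 * (𝐈 i ∙ 𝐈 i)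
      ≈⟨ +-cong (+-cong (*-congˡ (*-congˡ (𝐈-∙ i))) (*-congˡ (*-cong (sum-𝐈-row i) (sum-𝐈-row i)))) (-‿cong (*-congˡ (𝐈-∙ i))) ⟩
    fromℕ 2 * (fromℕ D * 1#) + fromℕ 2 * (1# * 1#) - fromℕ 4 * 1#
      ≈⟨ solve 1 (λ D → :2 :* (D :* :1) :+ :2 :* (:1 :* :1) :- con (+ 4) :* :1 := :2 :* D :- :2) refl (fromℕ D) ⟩
    fromℕ 2 * fromℕ D - fromℕ 2 ∎
    where open ≈-Reasoning

  -- The change of a good approximation between two prefixes: W and N are the weights and the
  -- numbers of the rows kept in between, U and T the scales of the two prefixes.
  module Window
    {D : ℕ} (W N : Fin D → Fin D → ℝ)
    (W-nonneg : ∀ a b → 0# ≤ W a b) (N-nonneg : ∀ a b → 0# ≤ N a b)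
    -- The only link between weights and counts. Rescaling is free, so one kept row can carry any
    -- weight, and the argument may only use which edges are present.
    (supported : ∀ a b → W a b ≈ 0# ⊎ 1# ≤ N a b)
    {T U ε δ κ : ℝ}
    (0≤U : 0# ≤ U) (0<T : 0# < T) (4U≤κT : fromℕ 4 * U ≤ κ * T)
    (0<ε : 0# < ε) (0≤δ : 0# ≤ δ) (0<κ : 0# < κ) (ε+κ≤1 : ε + κ ≤ 1#)
    (8δ≤κεTD : fromℕ 8 * δ ≤ κ * (ε * (T * fromℕ D)))
    (2≤D : fromℕ 2 ≤ fromℕ D) (1≤Dε² : 1# ≤ fromℕ D * (ε * ε))
    (upper : ∀ y → form (λ a b → W a b * χ a b) y ≤ (T * (1# + ε) - U * (1# - ε)) * form χ y + fromℕ 2 * δ * (y ∙ y))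
    (lower : ∀ y → (T * (1# - ε) - U * (1# + ε)) * form χ y - fromℕ 2 * δ * (y ∙ y) ≤ form (λ a b → W a b * χ a b) y)
    where

    Δ : Vector ℝ D → ℝ
    Δ = form (λ a b → W a b * χ a b)

    -- The condition on `𝐈` says that the vertices are distinct. Both orders are asked for because
    -- (a, b) and (b, a) are separate rows for one edge.
    neighbour : Fin D → Fin D → Set
    neighbour i j = (𝐈 i j ≡ 0#) × (1# ≤ N i j ⊎ 1# ≤ N j i)

    nb : Fin D → Vector ℝ D
    nb i j = 𝟙 (neighbour i j)

    nb-self : ∀ i → nb i i ≡ 0#
    nb-self i = 𝟙-false (λ (Iii≡0 , _) → 1≉0 (reflexive (≡.trans (≡.sym (𝐈-diag i)) Iii≡0)))

    nb≤N : ∀ i j → nb i j ≤ N i j + N j i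
    nb≤N i j with 𝟙-cases (neighbour i j)
    ... | inj₂ (_ , e) rewrite e = +-nonneg (N-nonneg i j) (N-nonneg j i)
    ... | inj₁ ((_ , inj₁ 1≤N) , e) rewrite e = ≤-trans 1≤N (≤-by (N-nonneg j i) refl)
    ... | inj₁ ((_ , inj₂ 1≤N) , e) rewrite e = ≤-trans 1≤N (≤-by (N-nonneg i j) (+-comm _ _))

    nb-∙ : ∀ i → nb i ∙ nb i ≈ sum (nb i)
    nb-∙ i = sum-cong (λ j → 𝟙-idem (neighbour i j))

    -- Every kept edge at i joins i to a neighbour.
    edge≤ : ∀ i a b → W a b * χ a b * ((𝐈 i a + 𝐈 i b) * (𝐈 i a + 𝐈 i b))
                    ≤ W a b * χ a b * ((𝐈 i a + 𝐈 i b) * (nb i a + nb i b))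
    edge≤ i a b with supported a b
    ... | inj₁ W≈0 = ≤-reflexive (trans (vanish _) (sym (vanish _)))
      where
      vanish : ∀ z → W a b * χ a b * z ≈ 0#
      vanish z = trans (*-congʳ (trans (*-congʳ W≈0) (zeroˡ _))) (zeroˡ z)
    ... | inj₂ 1≤N with 𝐈-cases i a | 𝐈-cases i b
    ...   | inj₂ e            | inj₂ f            = ≤-reflexive (untouched e f)
      where
      untouched : ∀ {w x y z} → x ≡ 0# → y ≡ 0# → w * ((x + y) * (x + y)) ≈ w * ((x + y) * z)
      untouched {w} {z = z} ≡.refl ≡.refl =
        solve 2 (λ w z → w :* ((:0 :+ :0) :* (:0 :+ :0)) := w :* ((:0 :+ :0) :* z)) refl w z
    ...   | inj₁ (≡.refl , e) | inj₁ (≡.refl , _) = ≤-reflexive (diagonal e)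
      where
      diagonal : ∀ {w x y z} → x ≡ 1# → w * (1# - x) * y ≈ w * (1# - x) * z
      diagonal {w} {y = y} {z} ≡.refl =
        solve 3 (λ w y z → w :* (:1 :- :1) :* y := w :* (:1 :- :1) :* z) refl w y z
    ...   | inj₁ (≡.refl , e) | inj₂ f            =
      ≤-reflexive (touched e f (nb-self a) (𝟙-true (f , inj₁ 1≤N)))
      where
      touched : ∀ {w x y u v} → x ≡ 1# → y ≡ 0# → u ≡ 0# → v ≡ 1# →
        w * ((x + y) * (x + y)) ≈ w * ((x + y) * (u + v))
      touched {w} ≡.refl ≡.refl ≡.refl ≡.refl =
        solve 1 (λ w → w :* ((:1 :+ :0) :* (:1 :+ :0)) := w :* ((:1 :+ :0) :* (:0 :+ :1))) refl w
    ...   | inj₂ e            | inj₁ (≡.refl , f) =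
      ≤-reflexive (touched e f (𝟙-true (e , inj₂ 1≤N)) (nb-self b))
      where
      touched : ∀ {w x y u v} → x ≡ 0# → y ≡ 1# → u ≡ 1# → v ≡ 0# →
        w * ((x + y) * (x + y)) ≈ w * ((x + y) * (u + v))
      touched {w} ≡.refl ≡.refl ≡.refl ≡.refl =
        solve 1 (λ w → w :* ((:0 :+ :1) :* (:0 :+ :1)) := w :* ((:0 :+ :1) :* (:1 :+ :0))) refl w

    scale-cross : ∀ (V : Fin D → Fin D → ℝ) (τ σ : ℝ) (x v : Vector ℝ D) →
      ∑∑ (λ a b → V a b * (((τ ·ᵥ x) a + (τ ·ᵥ x) b) * ((σ ·ᵥ v) a + (σ ·ᵥ v) b)))
      ≈ τ * σ * ∑∑ (λ a b → V a b * ((x a + x b) * (v a + v b)))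
    scale-cross V τ σ x v = trans
      (∑∑-cong (λ a b → solve 7 (λ w t s x y u v →
         w :* ((t :* x :+ t :* y) :* (s :* u :+ s :* v)) := t :* s :* (w :* ((x :+ y) :* (u :+ v))))
         refl (V a b) τ σ (x a) (x b) (v a) (v b)))
      (sym (*-distribˡ-∑∑ {D} _ _))

    module Vertex (i : Fin D) {τ : ℝ} (0<τ : 0# < τ) where

      p q : Vector ℝ D
      p = τ ·ᵥ 𝐈 i
      q = ε ·ᵥ nb i

      0≤4τε : 0# ≤ fromℕ 4 * (τ * ε)
      0≤4τε = *-nonneg (fromℕ-nonneg 4) (*-nonneg (<⇒≤ 0<τ) (<⇒≤ 0<ε))

      -- A kept edge at i has exactly one end at i and the other in the neighbourhood, so pairing
      -- e_i with the neighbourhood recovers the whole diagonal entry, however few neighbours there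
      -- are.
      Δ-polar≥ : fromℕ 4 * (τ * ε) * Δ (𝐈 i) ≤ Δ (p +ᵥ q) - Δ (p -ᵥ q)
      Δ-polar≥ = begin
        fromℕ 4 * (τ * ε) * Δ (𝐈 i)
          ≤⟨ *-monoʳ-≤ 0≤4τε (∑∑-mono (edge≤ i)) ⟩
        fromℕ 4 * (τ * ε) * ∑∑ (λ a b → W a b * χ a b * ((𝐈 i a + 𝐈 i b) * (nb i a + nb i b)))
          ≈⟨ *-assoc _ _ _ ⟩
        fromℕ 4 * (τ * ε * ∑∑ (λ a b → W a b * χ a b * ((𝐈 i a + 𝐈 i b) * (nb i a + nb i b))))
          ≈⟨ *-congˡ (scale-cross (λ a b → W a b * χ a b) τ ε (𝐈 i) (nb i)) ⟨
        fromℕ 4 * ∑∑ (λ a b → W a b * χ a b * ((p a + p b) * (q a + q b)))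
          ≈⟨ form-polar (λ a b → W a b * χ a b) p q ⟨
        Δ (p +ᵥ q) - Δ (p -ᵥ q) ∎
        where open ≤-Reasoning

      -- Since i is not its own neighbour, only the number of neighbours survives from `∑∑-cross`.
      -- This is the contrast with `Δ-polar≥`, whose diagonal entry is of order D.
      K-polar≤ : form χ (p +ᵥ q) - form χ (p -ᵥ q) ≤ fromℕ 8 * (τ * ε) * sum (nb i)
      K-polar≤ = begin
        form χ (p +ᵥ q) - form χ (p -ᵥ q)
          ≈⟨ form-polar χ p q ⟩
        fromℕ 4 * ∑∑ (λ a b → χ a b * ((p a + p b) * (q a + q b)))
          ≈⟨ *-congˡ (scale-cross χ τ ε (𝐈 i) (nb i)) ⟩
        fromℕ 4 * (τ * ε * ∑∑ (λ a b → χ a b * ((𝐈 i a + 𝐈 i b) * (nb i a + nb i b))))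
          ≈⟨ *-assoc _ _ _ ⟨
        fromℕ 4 * (τ * ε) * ∑∑ (λ a b → χ a b * ((𝐈 i a + 𝐈 i b) * (nb i a + nb i b)))
          ≤⟨ *-monoʳ-≤ 0≤4τε (∑∑-mono λ a b → ≤-trans
               (*-monoˡ-≤ (*-nonneg (+-nonneg (𝐈-nonneg i a) (𝐈-nonneg i b)) (+-nonneg (𝟙-nonneg _) (𝟙-nonneg _))) (χ≤1 a b))
               (≤-reflexive (*-identityˡ _))) ⟩
        fromℕ 4 * (τ * ε) * ∑∑ (λ a b → (𝐈 i a + 𝐈 i b) * (nb i a + nb i b))
          ≈⟨ *-congˡ (∑∑-cross (𝐈 i) (nb i)) ⟩
        fromℕ 4 * (τ * ε) * (fromℕ 2 * (fromℕ D * (𝐈 i ∙ nb i)) + fromℕ 2 * (sum (𝐈 i) * sum (nb i)))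
          ≈⟨ *-congˡ (+-cong (*-congˡ (*-congˡ (trans (sum-𝐈 i (nb i)) (reflexive (nb-self i))))) (*-congˡ (*-congʳ (sum-𝐈-row i)))) ⟩
        fromℕ 4 * (τ * ε) * (fromℕ 2 * (fromℕ D * 0#) + fromℕ 2 * (1# * sum (nb i)))
          ≈⟨ solve 3 (λ t d v → con (+ 4) :* t :* (:2 :* (d :* :0) :+ :2 :* (:1 :* v)) := con (+ 8) :* t :* v) refl (τ * ε) (fromℕ D) (sum (nb i)) ⟩
        fromℕ 8 * (τ * ε) * sum (nb i) ∎
        where open ≤-Reasoning

      norms : (p +ᵥ q) ∙ (p +ᵥ q) + (p -ᵥ q) ∙ (p -ᵥ q) ≈ fromℕ 2 * (τ * τ + ε * ε * sum (nb i))
      norms = trans (∙-parallelogram p q) (*-congˡ (+-cong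
        (trans (·ᵥ-∙ τ (𝐈 i)) (trans (*-congˡ (𝐈-∙ i)) (*-identityʳ _)))
        (trans (·ᵥ-∙ ε (nb i)) (*-congˡ (nb-∙ i)))))

    0≤ε : 0# ≤ ε
    0≤ε = <⇒≤ 0<ε

    0≤κ : 0# ≤ κ
    0≤κ = <⇒≤ 0<κ

    0≤T : 0# ≤ T
    0≤T = <⇒≤ 0<T

    0≤D : 0# ≤ fromℕ D
    0≤D = fromℕ-nonneg D

    0≤1-ε-κ : 0# ≤ 1# - (ε + κ)
    0≤1-ε-κ = x≤y⇒0≤y-x ε+κ≤1

    0≤1-ε : 0# ≤ 1# - ε
    0≤1-ε = x≤y⇒0≤y-x (≤-trans (≤-by 0≤κ refl) ε+κ≤1)

    0≤κT-4U : 0# ≤ κ * T - fromℕ 4 * U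
    0≤κT-4U = x≤y⇒0≤y-x 4U≤κT

    U≤T : U ≤ T
    U≤T = ≤-by (+-nonneg (+-nonneg (*-nonneg 0≤T (+-nonneg 0≤1-ε-κ 0≤ε)) 0≤κT-4U) (*-nonneg (fromℕ-nonneg 3) 0≤U))
      (solve 4 (λ T U ε κ → T := U :+ (T :* ((:1 :- (ε :+ κ)) :+ ε) :+ (κ :* T :- con (+ 4) :* U) :+ con (+ 3) :* U)) refl T U ε κ)

    0≤T-U : 0# ≤ T - U
    0≤T-U = x≤y⇒0≤y-x U≤T

    B : ℝ
    B = T * (1# - ε) - U * (1# + ε)

    0≤B : 0# ≤ B
    0≤B = ≤-by (+-nonneg (+-nonneg (*-nonneg 0≤T 0≤1-ε-κ) 0≤κT-4U)
                 (+-nonneg (*-nonneg 0≤U 0≤1-ε) (*-nonneg (fromℕ-nonneg 2) 0≤U)))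
      (solve 4 (λ T U ε κ → T :* (:1 :- ε) :- U :* (:1 :+ ε) :=
          :0 :+ (T :* (:1 :- (ε :+ κ)) :+ (κ :* T :- con (+ 4) :* U) :+ (U :* (:1 :- ε) :+ :2 :* U)))
        refl T U ε κ)

    -- In `B`, T (1 - ε) is at least κ T, while U (1 + ε) ≤ 2 U ≤ κ T / 2, so half of κ T survives
    -- the loss to the earlier prefix.
    0≤2B-κT : 0# ≤ fromℕ 2 * B - κ * T
    0≤2B-κT = ≤-by (+-nonneg (+-nonneg (*-nonneg (fromℕ-nonneg 2) (*-nonneg 0≤T 0≤1-ε-κ)) 0≤κT-4U)
                 (*-nonneg (fromℕ-nonneg 2) (*-nonneg 0≤U 0≤1-ε)))
      (solve 4 (λ T U ε κ → :2 :* (T :* (:1 :- ε) :- U :* (:1 :+ ε)) :- κ :* T :=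
          :0 :+ (:2 :* (T :* (:1 :- (ε :+ κ))) :+ (κ :* T :- con (+ 4) :* U) :+ :2 :* (U :* (:1 :- ε))))
        refl T U ε κ)

    0≤κεTD-8δ : 0# ≤ κ * (ε * (T * fromℕ D)) - fromℕ 8 * δ
    0≤κεTD-8δ = x≤y⇒0≤y-x 8δ≤κεTD

    0≤TD : 0# ≤ T * fromℕ D
    0≤TD = *-nonneg 0≤T 0≤D

    -- Turns the additive error into one more multiple of ε T D, the size of the multiplicative
    -- error at scale `T`.
    δ≤εTD : δ ≤ ε * (T * fromℕ D)
    δ≤εTD = ≤-by (+-nonneg (+-nonneg 0≤κεTD-8δ (*-nonneg (+-nonneg 0≤1-ε-κ 0≤ε) (*-nonneg 0≤ε 0≤TD)))
                   (*-nonneg (fromℕ-nonneg 7) 0≤δ))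
      (solve 4 (λ ε κ t δ → ε :* t := δ :+ ((κ :* (ε :* t) :- con (+ 8) :* δ) :+ ((:1 :- (ε :+ κ)) :+ ε) :* (ε :* t) :+ con (+ 7) :* δ))
        refl ε κ (T * fromℕ D) δ)

    -- The difference of `Δ` at p + q and p - q is estimated from both sides. The main terms get a
    -- factor ε from the length of `q`, the error terms get theirs from the approximation;
    -- cancelling ε T leaves an inequality that a small neighbourhood violates when τ is a small
    -- multiple of κ.
    vertex : ∀ (i : Fin D) {τ} → 0# < τ →
      τ * κ * fromℕ D ≤ fromℕ 8 * τ * sum (nb i) + fromℕ 20 * fromℕ D * (τ * τ + ε * ε * sum (nb i))
    vertex i {τ} 0<τ = *-cancelˡ-≤ (*-pos 0<ε 0<T) (begin
      ε * T * (τ * κ * fromℕ D)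
        -- B (2 D - 2) ≥ B D ≥ κ T D / 2 by `2≤D`, which the factor 4 turns into 2 κ T D; the
        -- additive term takes away 8 δ ≤ κ T D at most.
        ≤⟨ ≤-by (*-nonneg (*-nonneg 0≤τ 0≤ε) (+-nonneg (+-nonneg (+-nonneg
                   (*-nonneg 0≤2B-κT (*-nonneg (fromℕ-nonneg 2) 0≤D))
                   (*-nonneg (*-nonneg (fromℕ-nonneg 4) 0≤B) (x≤y⇒0≤y-x 2≤D)))
                   0≤κεTD-8δ)
                   (*-nonneg (*-nonneg 0≤κ 0≤TD) 0≤1-ε)))
             (solve 7 (λ ε T τ κ D δ B →
                con (+ 4) :* (τ :* ε) :* (B :* (:2 :* D :- :2) :- :2 :* δ :* :1) :=
                ε :* T :* (τ :* κ :* D) :+ τ :* ε :*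
                  ((:2 :* B :- κ :* T) :* (:2 :* D) :+ con (+ 4) :* B :* (D :- :2)
                   :+ (κ :* (ε :* (T :* D)) :- con (+ 8) :* δ) :+ κ :* (T :* D) :* (:1 :- ε)))
                refl ε T τ κ (fromℕ D) δ B) ⟩
      fromℕ 4 * (τ * ε) * (B * (fromℕ 2 * fromℕ D - fromℕ 2) - fromℕ 2 * δ * 1#)
        ≈⟨ *-congˡ (+-cong (*-congˡ (form-χ-𝐈 i)) (-‿cong (*-congˡ (𝐈-∙ i)))) ⟨
      fromℕ 4 * (τ * ε) * (B * form χ (𝐈 i) - fromℕ 2 * δ * (𝐈 i ∙ 𝐈 i))
        ≤⟨ *-monoʳ-≤ 0≤4τε (lower (𝐈 i)) ⟩
      fromℕ 4 * (τ * ε) * Δ (𝐈 i)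
        ≤⟨ Δ-polar≥ ⟩
      Δ (p +ᵥ q) - Δ (p -ᵥ q)
        ≤⟨ +-mono-≤ (upper (p +ᵥ q)) (neg-mono-≤ (lower (p -ᵥ q))) ⟩
      (T * (1# + ε) - U * (1# - ε)) * K₊ + fromℕ 2 * δ * n₊ - (B * K₋ - fromℕ 2 * δ * n₋)
        -- Regrouped so that the main terms form a difference, bounded by `K-polar≤`, and the errors
        -- form sums, bounded by `form-χ≤` and `norms`.
        ≈⟨ solve 8 (λ T U ε δ K₊ K₋ n₊ n₋ →
             (T :* (:1 :+ ε) :- U :* (:1 :- ε)) :* K₊ :+ :2 :* δ :* n₊
               :- ((T :* (:1 :- ε) :- U :* (:1 :+ ε)) :* K₋ :- :2 :* δ :* n₋) :=
             (T :- U) :* (K₊ :- K₋) :+ ε :* (T :+ U) :* (K₊ :+ K₋) :+ :2 :* δ :* (n₊ :+ n₋))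
             refl T U ε δ K₊ K₋ n₊ n₋ ⟩
      (T - U) * (K₊ - K₋) + ε * (T + U) * (K₊ + K₋) + fromℕ 2 * δ * (n₊ + n₋)
        ≤⟨ +-mono-≤ (+-mono-≤ (*-monoʳ-≤ 0≤T-U K-polar≤)
             (*-monoʳ-≤ (*-nonneg 0≤ε (+-nonneg 0≤T 0≤U)) (+-mono-≤ (form-χ≤ (p +ᵥ q)) (form-χ≤ (p -ᵥ q))))) ≤-refl ⟩
      (T - U) * (fromℕ 8 * (τ * ε) * V) + ε * (T + U) * (fromℕ 4 * fromℕ D * n₊ + fromℕ 4 * fromℕ D * n₋)
        + fromℕ 2 * δ * (n₊ + n₋)
        ≈⟨ +-cong (+-congˡ (*-congˡ (trans (sym (distribˡ _ _ _)) (*-congˡ norms)))) (*-congˡ norms) ⟩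
      (T - U) * (fromℕ 8 * (τ * ε) * V) + ε * (T + U) * (fromℕ 4 * fromℕ D * (fromℕ 2 * m))
        + fromℕ 2 * δ * (fromℕ 2 * m)
        -- With T + U ≤ 2 T the multiplicative error is at most 16 ε T D m, and 4 δ m ≤ 4 ε T D m
        -- brings the coefficient to 20.
        ≤⟨ ≤-by (+-nonneg (+-nonneg
                   (*-nonneg (*-nonneg (*-nonneg (fromℕ-nonneg 8) (*-nonneg 0≤τ 0≤ε)) 0≤V) 0≤U)
                   (*-nonneg (*-nonneg (*-nonneg (fromℕ-nonneg 8) (*-nonneg 0≤ε 0≤D)) 0≤m) 0≤T-U))
                   (*-nonneg (*-nonneg (fromℕ-nonneg 4) 0≤m) (x≤y⇒0≤y-x δ≤εTD)))
             (solve 8 (λ ε T U τ V D δ m →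
                ε :* T :* (con (+ 8) :* τ :* V :+ con (+ 20) :* D :* m) :=
                (T :- U) :* (con (+ 8) :* (τ :* ε) :* V) :+ ε :* (T :+ U) :* (con (+ 4) :* D :* (:2 :* m))
                  :+ :2 :* δ :* (:2 :* m)
                :+ (con (+ 8) :* (τ :* ε) :* V :* U :+ con (+ 8) :* (ε :* D) :* m :* (T :- U)
                  :+ con (+ 4) :* m :* (ε :* (T :* D) :- δ)))
                refl ε T U τ V (fromℕ D) δ m) ⟩
      ε * T * (fromℕ 8 * τ * V + fromℕ 20 * fromℕ D * m) ∎)
      where
      open ≤-Reasoning
      open Vertex i 0<τ
      V m K₊ K₋ n₊ n₋ : ℝ
      V = sum (nb i)
      m = τ * τ + ε * ε * V
      K₊ = form χ (p +ᵥ q)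
      K₋ = form χ (p -ᵥ q)
      n₊ = (p +ᵥ q) ∙ (p +ᵥ q)
      n₋ = (p -ᵥ q) ∙ (p -ᵥ q)
      0≤τ : 0# ≤ τ
      0≤τ = <⇒≤ 0<τ
      0≤V : 0# ≤ V
      0≤V = sum-nonneg (λ j → 𝟙-nonneg (neighbour i j))
      0≤m : 0# ≤ m
      0≤m = +-nonneg (square-nonneg τ) (*-nonneg (square-nonneg ε) 0≤V)

    -- A handshake count: a kept pair makes each of its two ends a neighbour of the other.
    ∑-nb≤ : sum (λ i → sum (nb i)) ≤ fromℕ 2 * ∑∑ N
    ∑-nb≤ = begin
      ∑∑ nb                            ≤⟨ ∑∑-mono nb≤N ⟩
      ∑∑ (λ i j → N i j + N j i)       ≈⟨ ∑∑-distrib-+ N (λ i j → N j i) ⟩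
      ∑∑ N + ∑∑ (λ i j → N j i)        ≈⟨ +-congˡ (∑-comm N) ⟨
      ∑∑ N + ∑∑ N                      ≈⟨ solve 1 (λ n → n :+ n := :2 :* n) refl (∑∑ N) ⟩
      fromℕ 2 * ∑∑ N                   ∎
      where open ≤-Reasoning

    -- 4480 = 80 · 28 · 2. With τ = κ/40 the difference τ κ D - 20 D τ² is κ² D / 80; `c≤28` bounds
    -- the coefficient of the neighbour count, absorbing 8 τ by τ ≤ 1 ≤ D ε²; and `∑-nb≤`
    -- contributes the 2.
    count : κ * κ * fromℕ D ≤ fromℕ 4480 * (ε * ε * ∑∑ N)
    count = *-cancelˡ-≤ 0<D (begin
      d * (κ * κ * d)
        ≈⟨ *-congˡ (*-congʳ (*-cong κ≈40τ κ≈40τ)) ⟩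
      d * (τ * fromℕ 40 * (τ * fromℕ 40) * d)
        ≈⟨ solve 2 (λ τ d → d :* (τ :* con (+ 40) :* (τ :* con (+ 40)) :* d) :=
                   con (+ 80) :* (d :* (τ :* (τ :* con (+ 40)) :* d) :- con (+ 20) :* d :* (d :* (τ :* τ)))) refl τ d ⟩
      fromℕ 80 * (d * (τ * (τ * fromℕ 40) * d) - fromℕ 20 * d * (d * (τ * τ)))
        ≈⟨ *-congˡ (+-congʳ (*-congˡ (*-congʳ (*-congˡ κ≈40τ)))) ⟨
      fromℕ 80 * (d * (τ * κ * d) - fromℕ 20 * d * (d * (τ * τ)))
        ≈⟨ *-congˡ (+-congʳ (sum-const D _)) ⟨
      fromℕ 80 * (sum {D} (λ _ → τ * κ * d) - fromℕ 20 * d * (d * (τ * τ)))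
        ≤⟨ *-monoʳ-≤ (fromℕ-nonneg 80) (+-monoˡ-≤ _ (sum-mono (λ i → vertex i 0<τ))) ⟩
      fromℕ 80 * (sum (λ i → fromℕ 8 * τ * V i + fromℕ 20 * d * (τ * τ + ε * ε * V i)) - fromℕ 20 * d * (d * (τ * τ)))
        ≈⟨ *-congˡ (+-congʳ (sum-cong (λ i → solve 5 (λ τ a d e v →
             a :* τ :* v :+ con (+ 20) :* d :* (τ :* τ :+ e :* v) := con (+ 20) :* d :* (τ :* τ) :+ (a :* τ :+ con (+ 20) :* d :* e) :* v)
             refl τ (fromℕ 8) d (ε * ε) (V i)))) ⟩
      fromℕ 80 * (sum (λ i → fromℕ 20 * d * (τ * τ) + c * V i) - fromℕ 20 * d * (d * (τ * τ)))
        ≈⟨ *-congˡ (+-congʳ (trans (∑-distrib-+ (λ _ → fromℕ 20 * d * (τ * τ)) (λ i → c * V i))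
             (+-cong (sum-const D _) (sym (*-distribˡ-∑ c V))))) ⟩
      fromℕ 80 * (d * (fromℕ 20 * d * (τ * τ)) + c * sum V - fromℕ 20 * d * (d * (τ * τ)))
        ≈⟨ solve 3 (λ d t x → con (+ 80) :* (d :* (con (+ 20) :* d :* t) :+ x :- con (+ 20) :* d :* (d :* t)) := con (+ 80) :* x) refl d (τ * τ) (c * sum V) ⟩
      fromℕ 80 * (c * sum V)
        ≤⟨ *-monoʳ-≤ (fromℕ-nonneg 80) (*-mono-≤ 0≤c (*-nonneg (fromℕ-nonneg 2) 0≤ΣN) c≤28 ∑-nb≤) ⟩
      fromℕ 80 * (fromℕ 28 * (d * (ε * ε)) * (fromℕ 2 * ∑∑ N))
        ≈⟨ solve 3 (λ d e n → con (+ 80) :* (con (+ 28) :* (d :* e) :* (:2 :* n)) := d :* (con (+ 4480) :* (e :* n))) refl d (ε * ε) (∑∑ N) ⟩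
      d * (fromℕ 4480 * (ε * ε * ∑∑ N)) ∎)
      where
      open ≤-Reasoning
      d τ c : ℝ
      d = fromℕ D
      -- Balances the main term τ κ D of vertex against its error term 20 D τ².
      τ = κ / fromℕ 40
      c = fromℕ 8 * τ + fromℕ 20 * d * (ε * ε)
      V : Fin D → ℝ
      V i = sum (nb i)
      0<D : 0# < d
      0<D = <-≤-trans (0<fromℕ[1+n] 1) 2≤D
      0<τ : 0# < τ
      0<τ = *-pos 0<κ (⁻¹-pos (0<fromℕ[1+n] 39))
      κ≈40τ : κ ≈ τ * fromℕ 40
      κ≈40τ = sym (x/y*y≈x κ (0<fromℕ[1+n] 39))
      0≤ΣN : 0# ≤ ∑∑ N
      0≤ΣN = sum-nonneg (λ a → sum-nonneg (N-nonneg a))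
      0≤c : 0# ≤ c
      0≤c = +-nonneg (*-nonneg (fromℕ-nonneg 8) (<⇒≤ 0<τ)) (*-nonneg (*-nonneg (fromℕ-nonneg 20) 0≤D) (square-nonneg ε))
      τ≤1 : τ ≤ 1#
      τ≤1 = *-cancelˡ-≤ (0<fromℕ[1+n] 39) (begin
        fromℕ 40 * τ    ≈⟨ trans (*-comm _ _) (sym κ≈40τ) ⟩
        κ               ≤⟨ ≤-by 0≤ε (+-comm ε κ) ⟩
        ε + κ           ≤⟨ ε+κ≤1 ⟩
        1#              ≤⟨ ≤-by (fromℕ-nonneg 39) (solve 0 (con (+ 40) :* :1 := :1 :+ con (+ 39)) refl) ⟩
        fromℕ 40 * 1#   ∎)
      c≤28 : c ≤ fromℕ 28 * (d * (ε * ε))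
      c≤28 = begin
        fromℕ 8 * τ + fromℕ 20 * d * (ε * ε)
          ≤⟨ +-monoˡ-≤ _ (*-monoʳ-≤ (fromℕ-nonneg 8) (≤-trans τ≤1 1≤Dε²)) ⟩
        fromℕ 8 * (d * (ε * ε)) + fromℕ 20 * d * (ε * ε)
          ≈⟨ solve 2 (λ d e → con (+ 8) :* (d :* e) :+ con (+ 20) :* d :* e := con (+ 28) :* (d :* e)) refl d (ε * ε) ⟩
        fromℕ 28 * (d * (ε * ε)) ∎

  -- Square roots, the spectral norm and the rows kept by an online algorithm

  √-isSupremum : ∀ {y} → 0# ≤ y → IsSupremum (λ z → z * z ≤ y) (√ y)
  √-isSupremum {y} 0≤y = sup-isSupremum _ (0# , ≤-respˡ-≈ (sym (zeroˡ 0#)) 0≤y)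
    (1# + y , λ {z} z²≤y → square-cancel-≤ (+-nonneg 0≤1 0≤y) (≤-trans z²≤y
      (≤-by (+-nonneg (+-nonneg 0≤1 0≤y) (square-nonneg y))
        (solve 1 (λ y → (:1 :+ y) :* (:1 :+ y) := y :+ (:1 :+ y :+ y :* y)) refl y))))

  √-upper : ∀ {y z} → 0# ≤ y → z * z ≤ y → z ≤ √ y
  √-upper 0≤y = proj₁ (√-isSupremum 0≤y)

  √-least : ∀ {y b} → 0# ≤ y → (∀ z → z * z ≤ y → z ≤ b) → √ y ≤ b
  √-least 0≤y h = proj₂ (√-isSupremum 0≤y) (λ {z} → h z)

  √-nonneg : ∀ {y} → 0# ≤ y → 0# ≤ √ y
  √-nonneg 0≤y = √-upper 0≤y (≤-respˡ-≈ (sym (zeroˡ 0#)) 0≤y)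

  -- Babylonian step: for r = √ y > 0, every z with z² ≤ y satisfies 2 r z ≤ r² + z² ≤ r² + y. Hence
  -- (r² + y)/(2 r) is an upper bound, so it is at least r, which rearranges to r² ≤ y.
  √-square≤ : ∀ {y} → 0# ≤ y → √ y * √ y ≤ y
  √-square≤ {y} 0≤y with em {0# < √ y}
  ... | no  0≮r = ≤-respˡ-≈ (trans (sym (zeroˡ 0#)) (*-cong 0≈r 0≈r)) 0≤y
    where
    0≈r : 0# ≈ √ y
    0≈r = ≤-antisym (√-nonneg 0≤y) (≮⇒≥ 0≮r)
  ... | yes 0<r = ≤-by (x≤y⇒0≤y-x 2r²≤r²+y) (solve 2 (λ r y → y := r :* r :+ (r :* r :+ y :- r :* (:2 :* r))) refl r y)
    where
    r : ℝ
    r = √ y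
    0<2r : 0# < fromℕ 2 * r
    0<2r = *-pos (0<fromℕ[1+n] 1) 0<r
    r≤ : r ≤ (r * r + y) / (fromℕ 2 * r)
    r≤ = √-least 0≤y λ z z²≤y → *-cancelˡ-≤ 0<2r (begin
      fromℕ 2 * r * z
        ≤⟨ ≤-by (+-nonneg (square-nonneg (r - z)) (x≤y⇒0≤y-x z²≤y))
             (solve 3 (λ r z y → r :* r :+ y := :2 :* r :* z :+ ((r :- z) :* (r :- z) :+ (y :- z :* z))) refl r z y) ⟩
      r * r + y
        ≈⟨ trans (*-comm _ _) (x/y*y≈x _ 0<2r) ⟨
      fromℕ 2 * r * ((r * r + y) / (fromℕ 2 * r)) ∎)
      where open ≤-Reasoning
    2r²≤r²+y : r * (fromℕ 2 * r) ≤ r * r + y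
    2r²≤r²+y = ≤-trans (*-monoˡ-≤ (<⇒≤ 0<2r) r≤) (≤-reflexive (x/y*y≈x _ 0<2r))

  √-square : ∀ {y} → 0# ≤ y → √ y * √ y ≈ y
  √-square {y} 0≤y = ≤-antisym (√-square≤ 0≤y) (0≤y-x⇒x≤y (≤-respʳ-≈ (begin
      - h * c               ≈⟨ solve 2 (λ h c → :- h :* c := :- (h :* c)) refl h c ⟩
      - (h * c)             ≈⟨ -‿cong hc ⟩
      - (y - r * r)         ≈⟨ solve 2 (λ y r → :- (y :- r :* r) := r :* r :- y) refl y r ⟩
      r * r - y             ∎) (*-nonneg 0≤-h (<⇒≤ 0<c))))
    where
    open ≈-Reasoning
    r c h : ℝ
    r = √ y
    -- The denominator makes h ≤ 1 as well as (r + h)² ≤ r² + h (2 r + 1) ≤ r² + h c = y. So r + h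
    -- still belongs to the set with supremum r, which forces h ≤ 0 and closes the gap y - r².
    c = fromℕ 2 * r + 1# + y
    h = (y - r * r) / c
    0≤r : 0# ≤ r
    0≤r = √-nonneg 0≤y
    0≤y-r² : 0# ≤ y - r * r
    0≤y-r² = x≤y⇒0≤y-x (√-square≤ 0≤y)
    0<c : 0# < c
    0<c = <-≤-trans 0<1 (≤-by (+-nonneg (*-nonneg (fromℕ-nonneg 2) 0≤r) 0≤y)
      (solve 2 (λ r y → :2 :* r :+ :1 :+ y := :1 :+ (:2 :* r :+ y)) refl r y))
    hc : h * c ≈ y - r * r
    hc = x/y*y≈x _ 0<c
    0≤h : 0# ≤ h
    0≤h = *-nonneg 0≤y-r² (<⇒≤ (⁻¹-pos 0<c))
    h≤1 : h ≤ 1#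
    h≤1 = x≤z*y⇒x/y≤z 0<c (≤-by (+-nonneg (+-nonneg (*-nonneg (fromℕ-nonneg 2) 0≤r) 0≤1) (square-nonneg r))
      (solve 2 (λ r y → :1 :* (:2 :* r :+ :1 :+ y) := y :- r :* r :+ (:2 :* r :+ :1 :+ r :* r)) refl r y))
    [r+h]²≤y : (r + h) * (r + h) ≤ y
    [r+h]²≤y = ≤-by (+-nonneg (*-nonneg 0≤h (x≤y⇒0≤y-x h≤1)) (*-nonneg 0≤h 0≤y))
      (trans (trans (solve 2 (λ y r → y := r :* r :+ (y :- r :* r)) refl y r) (+-congˡ (sym hc)))
        (solve 3 (λ r h y → r :* r :+ h :* (:2 :* r :+ :1 :+ y) := (r :+ h) :* (r :+ h) :+ (h :* (:1 :- h) :+ h :* y)) refl r h y))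
    0≤-h : 0# ≤ - h
    0≤-h = ≤-respʳ-≈ (solve 2 (λ r h → r :- (r :+ h) := :- h) refl r h) (x≤y⇒0≤y-x (√-upper 0≤y [r+h]²≤y))

  energy : ∀ {n d} → Matrix n d → Vector ℝ d → ℝ
  energy A x = (A *ᵥ x) ∙ (A *ᵥ x)

  energy-nonneg : ∀ {n d} (A : Matrix n d) x → 0# ≤ energy A x
  energy-nonneg A x = sum-nonneg (λ k → square-nonneg (A k ∙ x))

  ∥∥₂≈ : ∀ {n d} (A : Matrix n d) {s} → 0# < s → (∀ x → energy A x ≤ s * s * (x ∙ x)) →
         ∀ x₀ → x₀ ∙ x₀ ≈ 1# → energy A x₀ ≈ s * s → ∥ A ∥₂ ≈ s
  ∥∥₂≈ A {s} 0<s energy≤ x₀ x₀∙x₀≈1 energy-x₀ = ≤-antisym (proj₂ isSup (λ {r} → bound {r}))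
    (≤-trans (√-upper (energy-nonneg A x₀) (≤-reflexive (sym energy-x₀)))
      (proj₁ isSup attained))
    where
    open ≤-Reasoning
    S : ℝ → Set
    S r = ∃[ x ] (∥ x ∥ ≤ 1#) × (r ≈ ∥ A *ᵥ x ∥)
    0≤s : 0# ≤ s
    0≤s = <⇒≤ 0<s
    ∥x₀∥≤1 : ∥ x₀ ∥ ≤ 1#
    ∥x₀∥≤1 = √-least (≤-respʳ-≈ (sym x₀∙x₀≈1) 0≤1) λ z z²≤ → square-cancel-≤ 0≤1
      (≤-trans z²≤ (≤-reflexive (trans x₀∙x₀≈1 (sym (*-identityˡ 1#)))))
    attained : S ∥ A *ᵥ x₀ ∥
    attained = x₀ , ∥x₀∥≤1 , refl
    bound : IsUpperBound S s
    bound {r} (x , ∥x∥≤1 , r≈) = ≤-respˡ-≈ (sym r≈) (√-least (energy-nonneg A x) λ z z²≤ →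
      -- Dividing by s brings z² ≤ s² (x ∙ x) into the form that `√-upper` accepts, so that the
      -- length of x bounds z / s.
      let z/s≤1 : z / s ≤ 1#
          z/s≤1 = ≤-trans (√-upper (sum-nonneg (λ i → square-nonneg (x i))) (*-cancelˡ-≤ (*-pos 0<s 0<s) (begin
            s * s * (z / s * (z / s))     ≈⟨ solve 2 (λ s w → s :* s :* (w :* w) := w :* s :* (w :* s)) refl s (z / s) ⟩
            z / s * s * (z / s * s)       ≈⟨ *-cong (x/y*y≈x z 0<s) (x/y*y≈x z 0<s) ⟩
            z * z                         ≤⟨ z²≤ ⟩
            energy A x                    ≤⟨ energy≤ x ⟩
            s * s * (x ∙ x)               ∎))) ∥x∥≤1
      in begin
        z           ≈⟨ x/y*y≈x z 0<s ⟨
        z / s * s   ≤⟨ *-monoˡ-≤ 0≤s z/s≤1 ⟩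
        1# * s      ≈⟨ *-identityˡ s ⟩
        s           ∎)
    isSup : IsSupremum S ∥ A ∥₂
    isSup = sup-isSupremum S (_ , attained) (s , λ {r} → bound {r})

  qf : ∀ {d} → Matrix d d → Vector ℝ d → ℝ
  qf M x = x ∙ (M *ᵥ x)

  qf-⊖ : ∀ {d} (M N : Matrix d d) x → qf (M ⊖ N) x ≈ qf M x - qf N x
  qf-⊖ M N x = trans (sum-cong (λ i → trans
      (*-congˡ (trans (sum-cong (λ j → solve 3 (λ m n x → (m :- n) :* x := m :* x :- n :* x) refl (M i j) (N i j) (x j)))
        (∑-distrib-minus (λ j → M i j * x j) _)))
      (solve 3 (λ x a b → x :* (a :- b) := x :* a :- x :* b) refl (x i) (M i ∙ x) (N i ∙ x))))
    (∑-distrib-minus (λ i → x i * (M i ∙ x)) _)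

  qf-⊕ : ∀ {d} (M N : Matrix d d) x → qf (M ⊕ N) x ≈ qf M x + qf N x
  qf-⊕ M N x = trans (sum-cong (λ i → trans
      (*-congˡ (trans (sum-cong (λ j → distribʳ (x j) (M i j) (N i j))) (∑-distrib-+ (λ j → M i j * x j) _)))
      (distribˡ (x i) (M i ∙ x) (N i ∙ x))))
    (∑-distrib-+ (λ i → x i * (M i ∙ x)) _)

  qf-⊙ : ∀ {d} c (M : Matrix d d) x → qf (c ⊙ M) x ≈ c * qf M x
  qf-⊙ {d} c M x = trans (sum-cong (λ i → trans
      (*-congˡ (trans (sum-cong (λ j → *-assoc c (M i j) (x j))) (sym (*-distribˡ-∑ {d} c _))))
      (solve 3 (λ c x m → x :* (c :* m) := c :* (x :* m)) refl c (x i) (M i ∙ x))))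
    (sym (*-distribˡ-∑ {d} c _))

  qf-𝐈 : ∀ {d} (x : Vector ℝ d) → qf 𝐈 x ≈ x ∙ x
  qf-𝐈 x = sum-cong (λ i → *-congˡ (sum-𝐈 i x))

  qf-gram : ∀ {n d} (A : Matrix n d) x → qf (gram A) x ≈ energy A x
  qf-gram {n} {d} A x = begin
    sum (λ i → x i * sum (λ j → sum (λ k → A k i * A k j) * x j))
      ≈⟨ sum-cong {d} (λ i → *-congˡ (sum-cong {d} (λ j → *-distribʳ-∑ {n} (x j) _))) ⟩
    sum (λ i → x i * sum (λ j → sum (λ k → A k i * A k j * x j)))
      ≈⟨ sum-cong {d} (λ i → *-congˡ (∑-comm (λ j k → A k i * A k j * x j))) ⟩
    sum (λ i → x i * sum (λ k → sum (λ j → A k i * A k j * x j)))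
      ≈⟨ sum-cong {d} (λ i → *-congˡ (sum-cong {n} (λ k → trans (sum-cong {d} (λ j → *-assoc _ _ _)) (sym (*-distribˡ-∑ {d} _ _))))) ⟩
    sum (λ i → x i * sum (λ k → A k i * (A k ∙ x)))
      ≈⟨ sum-cong {d} (λ i → *-distribˡ-∑ {n} _ _) ⟩
    sum (λ i → sum (λ k → x i * (A k i * (A k ∙ x))))
      ≈⟨ ∑-comm (λ i k → x i * (A k i * (A k ∙ x))) ⟩
    sum (λ k → sum (λ i → x i * (A k i * (A k ∙ x))))
      ≈⟨ sum-cong {n} (λ k → trans (sum-cong {d} (λ i → solve 3 (λ x a e → x :* (a :* e) := a :* x :* e) refl (x i) (A k i) (A k ∙ x)))
           (sym (*-distribʳ-∑ {d} (A k ∙ x) _))) ⟩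
    energy A x ∎
    where open ≈-Reasoning

  weight : Maybe ℝ → ℝ
  weight (just w) = w * w
  weight nothing  = 0#

  keep : Maybe ℝ → ℝ
  keep (just _) = 1#
  keep nothing  = 0#

  weight-nonneg : ∀ m → 0# ≤ weight m
  weight-nonneg (just w) = square-nonneg w
  weight-nonneg nothing  = ≤-refl

  keep-nonneg : ∀ m → 0# ≤ keep m
  keep-nonneg (just _) = 0≤1
  keep-nonneg nothing  = ≤-refl

  weight-or-keep : ∀ m → weight m ≡ 0# ⊎ keep m ≡ 1#
  weight-or-keep (just _) = inj₂ ≡.refl
  weight-or-keep nothing  = inj₁ ≡.refl

  module _ {d : ℕ} where

    Policy : Set
    Policy = List (Vector ℝ d) → Vector ℝ d → Maybe ℝ

    -- Unlike `keptRows`, which forgets where its rows came from, this records the decision at every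
    -- position, so that runs on different matrices can be compared row by row.
    decisions : ∀ {n} → Policy → List (Vector ℝ d) → Matrix n d → Fin n → Maybe ℝ
    decisions f past A zero    = f past (head A)
    decisions f past A (suc k) = decisions f (head A ∷ past) (tail A) k

    -- This expresses being online: a decision depends only on the rows up to its own. The rows are
    -- compared by `≡` because a policy is an arbitrary function of vectors and may tell `≈`-equal
    -- entries apart.
    decisions-cong : ∀ {n} (f : Policy) past (A A′ : Matrix n d) k →
      (∀ j → toℕ j ℕ.≤ toℕ k → A j ≡ A′ j) → decisions f past A k ≡ decisions f past A′ k
    decisions-cong f past A A′ zero    eq = ≡.cong (f past) (eq zero ℕ.z≤n)
    decisions-cong f past A A′ (suc k) eq rewrite eq zero ℕ.z≤n =
      decisions-cong f (A′ zero ∷ past) (tail A) (tail A′) k (λ j j≤k → eq (suc j) (ℕ.s≤s j≤k))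

    energy-keptRows : ∀ {n} (f : Policy) past (A : Matrix n d) x →
      energy (fromList (keptRows f past A)) x
        ≈ sum (λ k → weight (decisions f past A k) * ((A k ∙ x) * (A k ∙ x)))
    energy-keptRows {zero}  f past A x = refl
    energy-keptRows {suc n} f past A x with f past (head A)
    ... | just w  = +-cong (trans (*-cong wA∙x wA∙x)
                      (solve 2 (λ w a → w :* a :* (w :* a) := w :* w :* (a :* a)) refl w (A zero ∙ x)))
                    (energy-keptRows f (head A ∷ past) (tail A) x)
      where
      wA∙x : (λ j → w * head A j) ∙ x ≈ w * (A zero ∙ x)
      wA∙x = trans (sum-cong (λ j → *-assoc w (A zero j) (x j))) (sym (*-distribˡ-∑ {d} w _))
    ... | nothing = trans (energy-keptRows f (head A ∷ past) (tail A) x)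
                      (trans (sym (+-identityˡ _)) (+-congʳ (sym (zeroˡ _))))

    length-keptRows : ∀ {n} (f : Policy) past (A : Matrix n d) →
      fromℕ (length (keptRows f past A)) ≈ sum (λ k → keep (decisions f past A k))
    length-keptRows {zero}  f past A = refl
    length-keptRows {suc n} f past A with f past (head A)
    ... | just w  = +-congˡ (length-keptRows f (head A ∷ past) (tail A))
    ... | nothing = trans (length-keptRows f (head A ∷ past) (tail A)) (sym (+-identityˡ _))

    length-keptRows≤ : ∀ {n} (f : Policy) past (A : Matrix n d) → length (keptRows f past A) ℕ.≤ n
    length-keptRows≤ {zero}  f past A = ℕ.z≤n
    length-keptRows≤ {suc n} f past A with f past (head A)
    ... | just w  = ℕ.s≤s (length-keptRows≤ f (head A ∷ past) (tail A))
    ... | nothing = ℕ.m≤n⇒m≤1+n (length-keptRows≤ f (head A ∷ past) (tail A))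

  -- Probability

  module Probability (space : ProbabilitySpace) where

    open ProbabilitySpace space

    ∅-event : Event ∅
    ∅-event = Event-resp ((λ ¬u → ¬u _) , λ ()) (∁-event U-event)

    -- Additivity is given for sequences of events only, so a union of two is padded with empty
    -- events.
    pair : Pred Ω 0ℓ → Pred Ω 0ℓ → ℕ → Pred Ω 0ℓ
    pair E F 0             = E
    pair E F 1             = F
    pair E F (suc (suc _)) = ∅

    pair-event : ∀ {E F} → Event E → Event F → ∀ i → Event (pair E F i)
    pair-event e f 0             = e
    pair-event e f 1             = f
    pair-event e f (suc (suc _)) = ∅-event

    ∪-event : ∀ {E F} → Event E → Event F → Event (⋃ ℕ (pair E F))
    ∪-event e f = ⋃-event _ (pair-event e f)

    ∩-event : ∀ {E F} → Event E → Event F → Event (E ∩ F)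
    ∩-event {E} {F} e f = Event-resp (to , from) (∁-event (∪-event (∁-event e) (∁-event f)))
      where
      to : ∀ {ω} → ¬ (⋃ ℕ (pair (∁ E) (∁ F)) ω) → E ω × F ω
      to {ω} h with em {E ω} | em {F ω}
      ... | yes Eω | yes Fω = Eω , Fω
      ... | no ¬Eω | _      = contradiction (0 , ¬Eω) h
      ... | yes _  | no ¬Fω = contradiction (1 , ¬Fω) h
      from : ∀ {ω} → E ω × F ω → ¬ (⋃ ℕ (pair (∁ E) (∁ F)) ω)
      from (Eω , _) (0 , ¬Eω) = ¬Eω Eω
      from (_ , Fω) (1 , ¬Fω) = ¬Fω Fω

    -- Two of the terms of the series for ∅ = ∅ ∪ ∅ ∪ … already give 2 ℙ ∅ ≤ ℙ ∅.
    ℙ-∅ : ∀ (e : Event ∅) → ℙ e ≈ 0#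
    ℙ-∅ e = ≤-antisym (≤-by (x≤y⇒0≤y-x 2ℙ≤ℙ) (solve 1 (λ p → :0 := p :+ (p :- (p :+ (p :+ :0)))) refl (ℙ e))) (ℙ-nonneg e)
      where
      2ℙ≤ℙ : ℙ e + (ℙ e + 0#) ≤ ℙ e
      2ℙ≤ℙ = ≤-trans
        (proj₁ (ℙ-σ-additive (λ _ → ∅) (λ _ → e) (λ _ _ ())) (2 , refl))
        (≤-reflexive (ℙ-cong (proj₂ , λ ()) _ e))

    ℙ-∪ : ∀ {E F G} (e : Event E) (f : Event F) (g : Event G) →
      (∀ {ω} → E ω → ¬ F ω) → (∀ {ω} → G ω → E ω ⊎ F ω) → (∀ {ω} → E ω ⊎ F ω → G ω) →
      ℙ g ≈ ℙ e + ℙ f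
    ℙ-∪ {E} {F} {G} e f g disjoint to from = trans (ℙ-cong (G⊆ , ⊆G) g (∪-event e f))
      (≤-antisym (proj₂ additive below)
        (≤-trans (≤-reflexive (+-congˡ (sym (+-identityʳ _)))) (proj₁ additive (2 , refl))))
      where
      G⊆ : ∀ {ω} → G ω → ⋃ ℕ (pair E F) ω
      G⊆ Gω with to Gω
      ... | inj₁ Eω = 0 , Eω
      ... | inj₂ Fω = 1 , Fω
      ⊆G : ∀ {ω} → ⋃ ℕ (pair E F) ω → G ω
      ⊆G (0 , Eω) = from (inj₁ Eω)
      ⊆G (1 , Fω) = from (inj₂ Fω)
      separated : ∀ {i j} → i ≢ j → Empty (pair E F i ∩ pair E F j)
      separated {0} {0} i≢j _ _ = i≢j ≡.refl
      separated {0} {1} _ _ (Eω , Fω) = disjoint Eω Fω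
      separated {1} {0} _ _ (Fω , Eω) = disjoint Eω Fω
      separated {1} {1} i≢j _ _ = i≢j ≡.refl
      additive : IsSupremum (λ s → ∃[ n ] s ≈ sum {n} (λ i → ℙ (pair-event e f (toℕ i)))) (ℙ (∪-event e f))
      additive = ℙ-σ-additive (pair E F) (pair-event e f) separated
      below : IsUpperBound (λ s → ∃[ n ] s ≈ sum {n} (λ i → ℙ (pair-event e f (toℕ i)))) (ℙ e + ℙ f)
      below (0 , s≈) = ≤-respˡ-≈ (sym s≈) (+-nonneg (ℙ-nonneg e) (ℙ-nonneg f))
      below (1 , s≈) = ≤-respˡ-≈ (sym s≈) (+-mono-≤ ≤-refl (ℙ-nonneg f))
      below (suc (suc n) , s≈) = ≤-reflexive (trans s≈ (+-congˡ
        (trans (+-congˡ (sum-zero {n} (λ _ → ℙ-∅ ∅-event))) (+-identityʳ _))))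

    -- A vector of these stands for a simple function, the sum of its a 1_E, and `integral` is
    -- summed formally over the vector. That pointwise comparison suffices, whatever the
    -- representation, is the content of `integral-mono`.
    Weighted : Set₁
    Weighted = ℝ × Σ[ E ∈ Pred Ω 0ℓ ] Event E

    value : Ω → Weighted → ℝ
    value ω (a , E , _) = a * 𝟙 (E ω)

    integral : Weighted → ℝ
    integral (a , _ , e) = a * ℙ e

    integral-on : ∀ {F} → Event F → Weighted → ℝ
    integral-on f (a , _ , e) = a * ℙ (∩-event f e)

    -- The induction splits `F` along the first event: inside, its coefficient moves into the
    -- constant `c`; outside, it is dropped. At the end the function is constant on `F`. An empty
    -- `F` says nothing about `c`, but then its probability is 0.
    integral-on-nonneg : ∀ {n F} (f : Event F) c (X : Vector Weighted n) →
      (∀ ω → F ω → 0# ≤ c + sum (λ i → value ω (X i))) →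
      0# ≤ c * ℙ f + sum (λ i → integral-on f (X i))
    integral-on-nonneg {zero} {F} f c X h with em {Σ[ ω ∈ Ω ] F ω}
    ... | yes (ω , Fω) = ≤-respʳ-≈ (sym (+-identityʳ _))
            (*-nonneg (≤-respʳ-≈ (+-identityʳ c) (h ω Fω)) (ℙ-nonneg f))
    ... | no ¬F = ≤-reflexive (sym (trans (+-identityʳ _) (trans (*-congˡ ℙf≈0) (zeroʳ c))))
      where
      ℙf≈0 : ℙ f ≈ 0#
      ℙf≈0 = trans (ℙ-cong ((λ {ω} Fω → ¬F (ω , Fω)) , λ ()) f ∅-event) (ℙ-∅ ∅-event)
    integral-on-nonneg {suc n} {F} f c X h = ≤-respʳ-≈ recombine (+-nonneg
        (integral-on-nonneg fe (c + a) X′ (λ ω (Fω , Eω) → ≤-respʳ-≈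
          (trans (+-congˡ (+-congʳ (trans (*-congˡ (reflexive (𝟙-true Eω))) (*-identityʳ a)))) (sym (+-assoc c a _))) (h ω Fω)))
        (integral-on-nonneg f¬e c X′ (λ ω (Fω , ¬Eω) → ≤-respʳ-≈
          (+-congˡ (trans (+-congʳ (trans (*-congˡ (reflexive (𝟙-false ¬Eω))) (zeroʳ a))) (+-identityˡ _))) (h ω Fω))))
      where
      a : ℝ
      a = proj₁ (X zero)
      E : Pred Ω 0ℓ
      E = proj₁ (proj₂ (X zero))
      e : Event E
      e = proj₂ (proj₂ (X zero))
      X′ : Vector Weighted n
      X′ i = X (suc i)
      fe : Event (F ∩ E)
      fe = ∩-event f e
      f¬e : Event (F ∩ ∁ E)
      f¬e = ∩-event f (∁-event e)
      split : ∀ {G} (g : Event G) → ℙ (∩-event f g) ≈ ℙ (∩-event fe g) + ℙ (∩-event f¬e g)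
      split {G} g = ℙ-∪ (∩-event fe g) (∩-event f¬e g) (∩-event f g)
        (λ ((_ , Eω) , _) ((_ , ¬Eω) , _) → ¬Eω Eω) cases
        λ { (inj₁ ((Fω , _) , Gω)) → Fω , Gω ; (inj₂ ((Fω , _) , Gω)) → Fω , Gω }
        where
        cases : ∀ {ω} → F ω × G ω → ((F ω × E ω) × G ω) ⊎ ((F ω × ¬ E ω) × G ω)
        cases {ω} (Fω , Gω) with em {E ω}
        ... | yes Eω = inj₁ ((Fω , Eω) , Gω)
        ... | no ¬Eω = inj₂ ((Fω , ¬Eω) , Gω)
      split-f : ℙ f ≈ ℙ fe + ℙ f¬e
      split-f = ℙ-∪ fe f¬e f (λ (_ , Eω) (_ , ¬Eω) → ¬Eω Eω) cases
        λ { (inj₁ (Fω , _)) → Fω ; (inj₂ (Fω , _)) → Fω }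
        where
        cases : ∀ {ω} → F ω → (F ω × E ω) ⊎ (F ω × ¬ E ω)
        cases {ω} Fω with em {E ω}
        ... | yes Eω = inj₁ (Fω , Eω)
        ... | no ¬Eω = inj₂ (Fω , ¬Eω)
      I I₁ I₂ : ℝ
      I  = sum (λ i → integral-on f (X′ i))
      I₁ = sum (λ i → integral-on fe (X′ i))
      I₂ = sum (λ i → integral-on f¬e (X′ i))
      recombine : (c + a) * ℙ fe + I₁ + (c * ℙ f¬e + I₂) ≈ c * ℙ f + (a * ℙ fe + I)
      recombine = begin
        (c + a) * ℙ fe + I₁ + (c * ℙ f¬e + I₂)
          ≈⟨ solve 6 (λ c a x y u v → (c :+ a) :* x :+ u :+ (c :* y :+ v) := c :* (x :+ y) :+ (a :* x :+ (u :+ v)))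
               refl c a (ℙ fe) (ℙ f¬e) I₁ I₂ ⟩
        c * (ℙ fe + ℙ f¬e) + (a * ℙ fe + (I₁ + I₂))
          ≈⟨ +-cong (*-congˡ split-f) (+-congˡ (trans
               (sum-cong (λ i → trans (*-congˡ (split (proj₂ (proj₂ (X′ i))))) (distribˡ _ _ _)))
               (∑-distrib-+ (λ i → integral-on fe (X′ i)) _))) ⟨
        c * ℙ f + (a * ℙ fe + I) ∎
        where open ≈-Reasoning

    integral-nonneg : ∀ {n} (X : Vector Weighted n) →
      (∀ ω → 0# ≤ sum (λ i → value ω (X i))) → 0# ≤ sum (λ i → integral (X i))
    integral-nonneg {n} X h = begin
      0#                                                        ≤⟨ integral-on-nonneg U-event 0# X (λ ω _ → ≤-respʳ-≈ (sym (+-identityˡ _)) (h ω)) ⟩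
      0# * ℙ U-event + sum (λ i → integral-on U-event (X i))    ≈⟨ +-congʳ (zeroˡ (ℙ U-event)) ⟩
      0# + sum (λ i → integral-on U-event (X i))                ≈⟨ +-identityˡ _ ⟩
      sum (λ i → integral-on U-event (X i))                     ≈⟨ sum-cong {n} (λ i → *-congˡ {proj₁ (X i)} (∩U (proj₂ (proj₂ (X i))))) ⟩
      sum (λ i → integral (X i))                                ∎
      where
      open ≤-Reasoning
      ∩U : ∀ {E} (e : Event E) → ℙ (∩-event U-event e) ≈ ℙ e
      ∩U e = ℙ-cong (proj₂ , λ Eω → _ , Eω) (∩-event U-event e) e

    sum-++ : ∀ {a} {A : Set a} {m n} (g : A → ℝ) (X : Vector A m) (Y : Vector A n) →
      sum (λ i → g ((X Vector.++ Y) i)) ≈ sum (λ i → g (X i)) + sum (λ i → g (Y i))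
    sum-++ {m = zero}  g X Y = sym (+-identityˡ _)
    sum-++ {m = suc m} {n} g X Y = begin
      g (X zero) + sum (λ i → g ((X Vector.++ Y) (suc i)))
        ≈⟨ +-congˡ (sum-cong {m ℕ.+ n} (λ i → reflexive (≡.cong g (shift i)))) ⟩
      g (X zero) + sum (λ i → g (((λ i → X (suc i)) Vector.++ Y) i))
        ≈⟨ +-congˡ (sum-++ g (λ i → X (suc i)) Y) ⟩
      g (X zero) + (sum (λ i → g (X (suc i))) + sum (λ i → g (Y i)))
        ≈⟨ +-assoc _ _ _ ⟨
      g (X zero) + sum (λ i → g (X (suc i))) + sum (λ i → g (Y i)) ∎
      where
      open ≈-Reasoning
      shift : ∀ i → (X Vector.++ Y) (suc i) ≡ ((λ i → X (suc i)) Vector.++ Y) i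
      shift i with splitAt m i
      ... | inj₁ _ = ≡.refl
      ... | inj₂ _ = ≡.refl

    negate : Weighted → Weighted
    negate (a , E) = - a , E

    -- Concatenating `Y` with the negated `X` represents the difference, to which `integral-nonneg`
    -- applies. The lengths are independent because successes and row counts are decomposed along
    -- different events.
    integral-mono : ∀ {m n} (X : Vector Weighted m) (Y : Vector Weighted n) →
      (∀ ω → sum (λ i → value ω (X i)) ≤ sum (λ j → value ω (Y j))) →
      sum (λ i → integral (X i)) ≤ sum (λ j → integral (Y j))
    integral-mono {m} {n} X Y h = 0≤y-x⇒x≤y (≤-respʳ-≈ (difference integral λ w → sym (-‿distribˡ-* _ _))
      (integral-nonneg (Y Vector.++ (λ i → negate (X i))) (λ ω →
        ≤-respʳ-≈ (sym (difference (value ω) (λ w → sym (-‿distribˡ-* _ _)))) (x≤y⇒0≤y-x (h ω)))))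
      where
      difference : ∀ (g : Weighted → ℝ) → (∀ w → g (negate w) ≈ - g w) →
        sum (λ i → g ((Y Vector.++ (λ i → negate (X i))) i)) ≈ sum (λ j → g (Y j)) - sum (λ i → g (X i))
      difference g neg = trans (sum-++ g Y (λ i → negate (X i))) (+-congˡ (trans
        (sum-cong (λ i → trans (neg (X i)) (sym (+-identityˡ _))))
        (trans (∑-distrib-minus (λ _ → 0#) (λ i → g (X i))) (trans (+-congʳ (sum-zero {m} (λ _ → refl))) (+-identityˡ _)))))

  -- The hard instance

  ∑-last : ∀ n (g : ℕ → ℝ) → sum {suc n} (λ i → g (toℕ i)) ≈ sum {n} (λ i → g (toℕ i)) + g n
  ∑-last n g = trans (sum-init-last {n} (λ i → g (toℕ i))) (+-cong
    (sum-cong {n} (λ i → reflexive (≡.cong g (Fin.toℕ-inject₁ i)))) (reflexive (≡.cong g (Fin.toℕ-fromℕ n))))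

  sum-↑ : ∀ m {n} (f : Vector ℝ (m ℕ.+ n)) → sum f ≈ sum (λ i → f (i ↑ˡ n)) + sum (λ j → f (m ↑ʳ j))
  sum-↑ zero    f = sym (+-identityˡ _)
  sum-↑ (suc m) f = trans (+-congˡ (sum-↑ m (tail f))) (sym (+-assoc _ _ _))

  sum-combine : ∀ m {n} (f : Vector ℝ (m ℕ.* n)) → sum f ≈ sum (λ i → sum (λ j → f (combine {m} {n} i j)))
  sum-combine zero        f = refl
  sum-combine (suc m) {n} f = trans (sum-↑ n f) (+-congˡ (sum-combine m (λ k → f (n ↑ʳ k))))

  module HardInstance (D L : ℕ) (s : ℝ) (S : ℕ → ℝ) (S₀≈0 : S 0 ≈ 0#) (S-mono : ∀ m → S m ≤ S (suc m)) where

    size : ℕ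
    size = L ℕ.* (D ℕ.* D)

    slot : Fin size → Fin L × Fin D × Fin D
    slot k = let (m , ab) = remQuot (D ℕ.* D) k in m , remQuot D ab

    -- The block is the most significant digit, so that rows come in the order of their blocks;
    -- `hard-agree` rests on this.
    place : Fin L → Fin D → Fin D → Fin size
    place m a b = combine m (combine a b)

    slot-place : ∀ m a b → slot (place m a b) ≡ (m , a , b)
    slot-place m a b = ≡.trans
      (≡.cong (λ (m , ab) → m , remQuot D ab) (Fin.remQuot-combine m (combine a b)))
      (≡.cong (m ,_) (Fin.remQuot-combine a b))

    place-slot : ∀ k → let (m , a , b) = slot k in place m a b ≡ k
    place-slot k = ≡.trans (≡.cong (combine (proj₁ (remQuot {L} (D ℕ.* D) k))) (Fin.combine-remQuot {D} D _))
      (Fin.combine-remQuot {L} (D ℕ.* D) k)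

    sum-place : ∀ (f : Vector ℝ size) → sum f ≈ sum (λ (m : Fin L) → ∑∑ (λ a b → f (place m a b)))
    sum-place f = trans (sum-combine L f)
      (sum-cong {L} (λ m → sum-combine D {D} (λ ab → f (combine {L} {D ℕ.* D} m ab))))

    S-mono-≤ : ∀ {ℓ m} → ℓ ℕ.≤ m → S ℓ ≤ S m
    S-mono-≤ ℓ≤m = go (ℕ.≤⇒≤′ ℓ≤m)
      where
      go : ∀ {ℓ m} → ℓ ℕ.≤′ m → S ℓ ≤ S m
      go (ℕ.≤′-reflexive ≡.refl) = ≤-refl
      go (ℕ.≤′-step ℓ≤m)         = ≤-trans (go ℓ≤m) (S-mono _)

    jump : ℕ → ℝ
    jump m = S (suc m) - S m

    jump-nonneg : ∀ m → 0# ≤ jump m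
    jump-nonneg m = x≤y⇒0≤y-x (S-mono m)

    before : ℕ → ℕ → ℝ
    before ℓ m = if m ℕ.<ᵇ ℓ then 1# else 0#

    -- The square root makes block m add exactly `jump m` times `form χ` to the energy. For a = b
    -- the row is zero, and every edge occurs twice, as (a, b) and (b, a).
    edge : ℕ → Fin D → Fin D → Vector ℝ (suc D)
    edge m a b zero    = 0#
    edge m a b (suc j) = √ (jump m) * χ a b * (𝐈 a j + 𝐈 b j)

    -- Blocks beyond the prefix become zero rows instead of being cut off: an algorithm is told the
    -- number of rows, and a shorter matrix could make it behave differently from the start.
    row : ℕ → Fin L × Fin D × Fin D → Vector ℝ (suc D)
    row ℓ (m , a , b) = if toℕ m ℕ.<ᵇ ℓ then edge (toℕ m) a b else (λ _ → 0#)

    hard : ℕ → Matrix (suc size) (suc D)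
    hard ℓ zero    = λ j → s * 𝐈 zero j
    hard ℓ (suc k) = row ℓ (slot k)

    first-∙ : ∀ x → (λ j → s * 𝐈 zero j) ∙ x ≈ s * x zero
    first-∙ x = trans (sum-cong {suc D} (λ j → *-assoc s (𝐈 zero j) (x j)))
      (trans (sym (*-distribˡ-∑ {suc D} s (λ j → 𝐈 zero j * x j))) (*-congˡ (sum-𝐈 zero x)))

    edge-∙ : ∀ m a b x → edge m a b ∙ x ≈ √ (jump m) * χ a b * (x (suc a) + x (suc b))
    edge-∙ m a b x = begin
      0# * x zero + sum (λ j → √ (jump m) * χ a b * (𝐈 a j + 𝐈 b j) * x (suc j))
        ≈⟨ trans (+-congʳ (zeroˡ _)) (+-identityˡ _) ⟩
      sum (λ j → √ (jump m) * χ a b * (𝐈 a j + 𝐈 b j) * x (suc j))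
        ≈⟨ sum-cong {D} (λ j → trans (*-assoc (√ (jump m) * χ a b) (𝐈 a j + 𝐈 b j) (x (suc j))) (*-congˡ (distribʳ (x (suc j)) (𝐈 a j) (𝐈 b j)))) ⟩
      sum (λ j → √ (jump m) * χ a b * (𝐈 a j * x (suc j) + 𝐈 b j * x (suc j)))
        ≈⟨ *-distribˡ-∑ {D} _ _ ⟨
      √ (jump m) * χ a b * sum (λ j → 𝐈 a j * x (suc j) + 𝐈 b j * x (suc j))
        ≈⟨ *-congˡ (trans (∑-distrib-+ (λ j → 𝐈 a j * x (suc j)) _) (+-cong (sum-𝐈 a (tail x)) (sum-𝐈 b (tail x)))) ⟩
      √ (jump m) * χ a b * (x (suc a) + x (suc b)) ∎
      where open ≈-Reasoning

    square : Vector ℝ (suc D) → Fin D → Fin D → ℝ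
    square x a b = (x (suc a) + x (suc b)) * (x (suc a) + x (suc b))

    edge-∙² : ∀ m a b x → (edge m a b ∙ x) * (edge m a b ∙ x) ≈ jump m * (χ a b * square x a b)
    edge-∙² m a b x = begin
      (edge m a b ∙ x) * (edge m a b ∙ x)
        ≈⟨ *-cong (edge-∙ m a b x) (edge-∙ m a b x) ⟩
      √ (jump m) * χ a b * y * (√ (jump m) * χ a b * y)
        ≈⟨ solve 3 (λ r c y → r :* c :* y :* (r :* c :* y) := r :* r :* (c :* c :* (y :* y))) refl (√ (jump m)) (χ a b) y ⟩
      √ (jump m) * √ (jump m) * (χ a b * χ a b * (y * y))
        ≈⟨ *-cong (√-square (jump-nonneg m)) (*-congʳ (χ-idem a b)) ⟩
      jump m * (χ a b * (y * y)) ∎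
      where
      open ≈-Reasoning
      y : ℝ
      y = x (suc a) + x (suc b)

    row-∙² : ∀ ℓ m a b x → let r = row ℓ (m , a , b) ∙ x in
      r * r ≈ before ℓ (toℕ m) * (jump (toℕ m) * (χ a b * square x a b))
    row-∙² ℓ m a b x with toℕ m ℕ.<ᵇ ℓ
    ... | true  = trans (edge-∙² (toℕ m) a b x) (sym (*-identityˡ _))
    ... | false = trans (*-congʳ (sum-zero {suc D} (λ j → zeroˡ (x j)))) (trans (zeroˡ _) (sym (zeroˡ _)))

    hard-∙² : ∀ ℓ m a b x → let r = hard ℓ (suc (place m a b)) ∙ x in
      r * r ≈ before ℓ (toℕ m) * (jump (toℕ m) * (χ a b * square x a b))
    hard-∙² ℓ m a b x = ≡.subst
      (λ p → (row ℓ p ∙ x) * (row ℓ p ∙ x) ≈ before ℓ (toℕ m) * (jump (toℕ m) * (χ a b * square x a b)))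
      (≡.sym (slot-place m a b)) (row-∙² ℓ m a b x)

    -- The sequence is quantified afresh, shadowing the module parameter, so that the induction can
    -- pass to its shift.
    telescope : ∀ (S : ℕ → ℝ) {ℓ n} → ℓ ℕ.≤ n →
      sum {n} (λ m → before ℓ (toℕ m) * (S (suc (toℕ m)) - S (toℕ m))) ≈ S ℓ - S 0
    telescope S {n = n} ℕ.z≤n = trans (sum-zero {n} (λ m → zeroˡ _)) (sym (-‿inverseʳ _))
    telescope S (ℕ.s≤s {ℓ} {n} ℓ≤n) = trans (+-congˡ (telescope (λ k → S (suc k)) ℓ≤n))
      (solve 3 (λ a b c → :1 :* (b :- a) :+ (c :- b) := c :- a) refl (S 0) (S 1) (S (suc ℓ)))

    energy-hard : ∀ {ℓ} → ℓ ℕ.≤ L → ∀ x → energy (hard ℓ) x ≈ s * s * (x zero * x zero) + S ℓ * form χ (tail x)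
    energy-hard {ℓ} ℓ≤L x = +-cong
      (trans (*-cong (first-∙ x) (first-∙ x)) (solve 2 (λ s x → s :* x :* (s :* x) := s :* s :* (x :* x)) refl s (x zero)))
      (begin
        sum (λ k → (row ℓ (slot k) ∙ x) * (row ℓ (slot k) ∙ x))
          ≈⟨ sum-place (λ k → (row ℓ (slot k) ∙ x) * (row ℓ (slot k) ∙ x)) ⟩
        sum (λ (m : Fin L) → ∑∑ (λ a b → (hard ℓ (suc (place m a b)) ∙ x) * (hard ℓ (suc (place m a b)) ∙ x)))
          ≈⟨ sum-cong {L} (λ m → ∑∑-cong {D} (λ a b → trans (hard-∙² ℓ m a b x) (sym (*-assoc _ _ _)))) ⟩
        sum (λ (m : Fin L) → ∑∑ (λ a b → before ℓ (toℕ m) * jump (toℕ m) * (χ a b * square x a b)))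
          ≈⟨ sum-cong {L} (λ m → *-distribˡ-∑∑ {D} _ _) ⟨
        sum (λ (m : Fin L) → before ℓ (toℕ m) * jump (toℕ m) * form χ (tail x))
          ≈⟨ *-distribʳ-∑ {L} _ _ ⟨
        sum (λ (m : Fin L) → before ℓ (toℕ m) * jump (toℕ m)) * form χ (tail x)
          ≈⟨ *-congʳ (telescope S ℓ≤L) ⟩
        (S ℓ - S 0) * form χ (tail x)
          ≈⟨ *-congʳ (trans (+-congˡ (-‿cong S₀≈0)) (solve 1 (λ x → x :- :0 := x) refl (S ℓ))) ⟩
        S ℓ * form χ (tail x) ∎)
      where open ≈-Reasoning

    hard-agree : ∀ {ℓ} m a b → toℕ m ℕ.< ℓ → ∀ j →
      toℕ j ℕ.≤ toℕ (suc (place m a b)) → hard ℓ j ≡ hard L j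
    hard-agree m a b m<ℓ zero    _ = ≡.refl
    hard-agree {ℓ} m a b m<ℓ (suc k) (ℕ.s≤s k≤) = row-agree (slot k) (place-slot k)
      where
      row-agree : ∀ p → (let (m′ , a′ , b′) = p in place m′ a′ b′ ≡ k) → row ℓ p ≡ row L p
      row-agree (m′ , a′ , b′) e = ≡.trans (is-edge m′<ℓ) (≡.sym (is-edge (Fin.toℕ<n m′)))
        where
        m′<ℓ : toℕ m′ ℕ.< ℓ
        m′<ℓ = ℕ.≤-<-trans (ℕ.≮⇒≥ λ m<m′ → ℕ.<⇒≱
          (Fin.combine-monoˡ-< (combine a b) (combine a′ b′) m<m′)
          (≡.subst (λ i → toℕ i ℕ.≤ toℕ (place m a b)) (≡.sym e) k≤)) m<ℓ
        is-edge : ∀ {ℓ} → toℕ m′ ℕ.< ℓ → row ℓ (m′ , a′ , b′) ≡ edge (toℕ m′) a′ b′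
        is-edge {ℓ} m′<ℓ with toℕ m′ ℕ.<ᵇ ℓ | ℕ.<⇒<ᵇ m′<ℓ
        ... | true | _ = ≡.refl

    -- Test vectors vanish at coordinate 0, which hides the large first row and whatever weight the
    -- algorithm gives it.
    pad : Vector ℝ D → Vector ℝ (suc D)
    pad y zero    = 0#
    pad y (suc j) = y j

    pad-∙ : ∀ y → pad y ∙ pad y ≈ y ∙ y
    pad-∙ y = trans (+-congʳ (zeroˡ 0#)) (+-identityˡ _)

    energy-hard-pad : ∀ {ℓ} → ℓ ℕ.≤ L → ∀ y → energy (hard ℓ) (pad y) ≈ S ℓ * form χ y
    energy-hard-pad ℓ≤L y = trans (energy-hard ℓ≤L (pad y))
      (trans (+-congʳ (trans (*-congˡ (zeroˡ 0#)) (zeroʳ _))) (+-identityˡ _))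

    module Run (f : Policy {suc D}) where

      choice : Fin L → Fin D → Fin D → Maybe ℝ
      choice m a b = decisions f [] (hard L) (suc (place m a b))

      P C : ℕ → Fin D → Fin D → ℝ
      P ℓ a b = sum (λ (m : Fin L) → before ℓ (toℕ m) * (weight (choice m a b) * jump (toℕ m)))
      C ℓ a b = sum (λ (m : Fin L) → before ℓ (toℕ m) * keep (choice m a b))

      kept : ℕ → Vector ℝ D → ℝ
      kept ℓ = form (λ a b → P ℓ a b * χ a b)

      -- Within the prefix the decisions agree with `choice`. On the zero rows that follow they may
      -- differ, but there the factor `before` vanishes.
      before-choice : ∀ ℓ m a b z →
        weight (decisions f [] (hard ℓ) (suc (place m a b))) * (before ℓ (toℕ m) * z)
          ≈ weight (choice m a b) * (before ℓ (toℕ m) * z)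
      before-choice ℓ m a b z with toℕ m ℕ.<ᵇ ℓ in eq
      ... | true  = *-congʳ (reflexive (≡.cong weight
        (decisions-cong f [] (hard ℓ) (hard L) (suc (place m a b))
          (hard-agree m a b (ℕ.<ᵇ⇒< _ _ (≡.subst Bool.T (≡.sym eq) _))))))
      ... | false = trans (*-congˡ (zeroˡ z)) (trans (zeroʳ _) (sym (trans (*-congˡ (zeroˡ z)) (zeroʳ _))))

      energy-kept : ∀ ℓ y → energy (fromList (keptRows f [] (hard ℓ))) (pad y) ≈ kept ℓ y
      energy-kept ℓ y = begin
        energy (fromList (keptRows f [] (hard ℓ))) x
          ≈⟨ energy-keptRows f [] (hard ℓ) x ⟩
        weight (dec zero) * ((hard ℓ zero ∙ x) * (hard ℓ zero ∙ x)) + sum (λ k → weight (dec (suc k)) * ((row ℓ (slot k) ∙ x) * (row ℓ (slot k) ∙ x)))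
          ≈⟨ +-congʳ (trans (*-congˡ (trans (*-congʳ (trans (first-∙ x) (zeroʳ s))) (zeroˡ _))) (zeroʳ _)) ⟩
        0# + sum (λ k → weight (dec (suc k)) * ((row ℓ (slot k) ∙ x) * (row ℓ (slot k) ∙ x)))
          ≈⟨ +-identityˡ _ ⟩
        sum (λ k → weight (dec (suc k)) * ((row ℓ (slot k) ∙ x) * (row ℓ (slot k) ∙ x)))
          ≈⟨ sum-place (λ k → weight (dec (suc k)) * ((row ℓ (slot k) ∙ x) * (row ℓ (slot k) ∙ x))) ⟩
        sum (λ (m : Fin L) → ∑∑ (λ a b → weight (dec (suc (place m a b))) * ((hard ℓ (suc (place m a b)) ∙ x) * (hard ℓ (suc (place m a b)) ∙ x))))
          ≈⟨ sum-cong {L} (λ m → ∑∑-cong {D} (λ a b → trans (*-congˡ (hard-∙² ℓ m a b x))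
               (trans (before-choice ℓ m a b _)
                 (solve 5 (λ w t j c q → w :* (t :* (j :* (c :* q))) := t :* (w :* j) :* (c :* q)) refl
                   (weight (choice m a b)) (before ℓ (toℕ m)) (jump (toℕ m)) (χ a b) (square x a b))))) ⟩
        sum (λ (m : Fin L) → ∑∑ (λ a b → before ℓ (toℕ m) * (weight (choice m a b) * jump (toℕ m)) * (χ a b * square x a b)))
          ≈⟨ ∑-comm (λ m a → sum (λ b → before ℓ (toℕ m) * (weight (choice m a b) * jump (toℕ m)) * (χ a b * square x a b))) ⟩
        sum (λ a → sum (λ m → sum (λ b → before ℓ (toℕ m) * (weight (choice m a b) * jump (toℕ m)) * (χ a b * square x a b))))
          ≈⟨ sum-cong {D} (λ a → ∑-comm (λ m b → before ℓ (toℕ m) * (weight (choice m a b) * jump (toℕ m)) * (χ a b * square x a b))) ⟩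
        ∑∑ (λ a b → sum (λ (m : Fin L) → before ℓ (toℕ m) * (weight (choice m a b) * jump (toℕ m)) * (χ a b * square x a b)))
          ≈⟨ ∑∑-cong {D} (λ a b → trans (sym (*-distribʳ-∑ {L} (χ a b * square x a b) _)) (sym (*-assoc _ _ _))) ⟩
        kept ℓ y ∎
        where
        open ≈-Reasoning
        x : Vector ℝ (suc D)
        x = pad y
        dec : Fin (suc size) → Maybe ℝ
        dec = decisions f [] (hard ℓ)

      total : ℕ → ℝ
      total ℓ = ∑∑ (C ℓ)

      total≤length : ∀ ℓ → total ℓ ≤ fromℕ (length (keptRows f [] (hard L)))
      total≤length ℓ = begin
        ∑∑ (λ a b → sum (λ (m : Fin L) → before ℓ (toℕ m) * keep (choice m a b)))
          ≤⟨ ∑∑-mono {D} (λ a b → sum-mono {L} (λ m → drop-before ℓ (toℕ m) (keep-nonneg (choice m a b)))) ⟩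
        ∑∑ (λ a b → sum (λ m → keep (choice m a b)))
          ≈⟨ sum-cong {D} (λ a → ∑-comm (λ m b → keep (choice m a b))) ⟨
        sum (λ a → sum (λ m → sum (λ b → keep (choice m a b))))
          ≈⟨ ∑-comm (λ m a → sum (λ b → keep (choice m a b))) ⟨
        sum (λ (m : Fin L) → ∑∑ (λ a b → keep (choice m a b)))
          ≈⟨ sum-place (λ k → keep (decisions f [] (hard L) (suc k))) ⟨
        sum (λ k → keep (decisions f [] (hard L) (suc k)))
          ≤⟨ ≤-by (keep-nonneg (f [] (head (hard L)))) (+-comm _ _) ⟩
        sum (λ k → keep (decisions f [] (hard L) k))
          ≈⟨ length-keptRows f [] (hard L) ⟨
        fromℕ (length (keptRows f [] (hard L))) ∎
        where
        open ≤-Reasoning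
        drop-before : ∀ ℓ m {z} → 0# ≤ z → before ℓ m * z ≤ z
        drop-before ℓ m {z} 0≤z with m ℕ.<ᵇ ℓ
        ... | true  = ≤-reflexive (*-identityˡ z)
        ... | false = ≤-respˡ-≈ (sym (zeroˡ z)) 0≤z

      module Count {ε δ κ : ℝ} (0<ε : 0# < ε) (0≤δ : 0# ≤ δ) (0<κ : 0# < κ) (ε+κ≤1 : ε + κ ≤ 1#)
        (2≤D : fromℕ 2 ≤ fromℕ D) (1≤Dε² : 1# ≤ fromℕ D * (ε * ε))
        (S-pos : ∀ m → 0# < S (suc m)) (4S≤κS : ∀ m → fromℕ 4 * S m ≤ κ * S (suc m))
        (8δ≤κεSD : ∀ m → fromℕ 8 * δ ≤ κ * (ε * (S (suc m) * fromℕ D))) where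

        Good : ℕ → Set
        Good ℓ = ∀ y → ((1# - ε) * (S ℓ * form χ y) - δ * (y ∙ y) ≤ kept ℓ y)
                     × (kept ℓ y ≤ (1# + ε) * (S ℓ * form χ y) + δ * (y ∙ y))

        -- Serves as the start of the first window: nothing has been kept and the scale is 0, so the
        -- bounds hold without appeal to the algorithm.
        good-zero : Good 0
        good-zero y =
            ≤-respʳ-≈ (sym kept≈0) (≤-by 0≤δn (trans (sym S₀K≈0)
              (solve 2 (λ k n → k := k :- n :+ n) refl ((1# - ε) * (S 0 * form χ y)) (δ * (y ∙ y)))))
          , ≤-respˡ-≈ (sym kept≈0) (≤-by 0≤δn (+-congʳ S₀K≈0))
          where
          0≤δn : 0# ≤ δ * (y ∙ y)
          0≤δn = *-nonneg 0≤δ (sum-nonneg (λ j → square-nonneg (y j)))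
          S₀K≈0 : ∀ {c} → c * (S 0 * form χ y) ≈ 0#
          S₀K≈0 = trans (*-congˡ (trans (*-congʳ S₀≈0) (zeroˡ _))) (zeroʳ _)
          kept≈0 : kept 0 y ≈ 0#
          kept≈0 = sum-zero {D} (λ a → sum-zero {D} (λ b → trans (*-congʳ (trans (*-congʳ
            (sum-zero {L} (λ m → zeroˡ _))) (zeroˡ _))) (zeroˡ _)))

        S-nonneg : ∀ m → 0# ≤ S m
        S-nonneg zero    = ≤-reflexive (sym S₀≈0)
        S-nonneg (suc m) = <⇒≤ (S-pos m)

        during : ℕ → ℕ → ℕ → ℝ
        during ℓ ℓ′ m = before ℓ′ m - before ℓ m

        during-cases : ∀ {ℓ ℓ′} → ℓ ℕ.≤ ℓ′ → ∀ m → during ℓ ℓ′ m ≈ 1# ⊎ during ℓ ℓ′ m ≈ 0#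
        during-cases {ℓ} {ℓ′} ℓ≤ℓ′ m with m ℕ.<ᵇ ℓ in p | m ℕ.<ᵇ ℓ′ in q
        ... | true  | true  = inj₂ (-‿inverseʳ 1#)
        ... | false | true  = inj₁ (solve 0 (:1 :- :0 := :1) refl)
        ... | false | false = inj₂ (-‿inverseʳ 0#)
        ... | true  | false with () ← ≡.subst Bool.T q
          (ℕ.<⇒<ᵇ (ℕ.<-≤-trans (ℕ.<ᵇ⇒< m ℓ (≡.subst Bool.T (≡.sym p) _)) ℓ≤ℓ′))

        during-nonneg : ∀ {ℓ ℓ′} → ℓ ℕ.≤ ℓ′ → ∀ m → 0# ≤ during ℓ ℓ′ m
        during-nonneg ℓ≤ℓ′ m with during-cases ℓ≤ℓ′ m
        ... | inj₁ e = ≤-respʳ-≈ (sym e) 0≤1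
        ... | inj₂ e = ≤-reflexive (sym e)

        window : ∀ {ℓ m} → ℓ ℕ.≤ m → Good ℓ → Good (suc m) →
          κ * κ * fromℕ D ≤ fromℕ 4480 * (ε * ε * (total (suc m) - total ℓ))
        window {ℓ} {m} ℓ≤m good-ℓ good-ℓ′ = ≤-respʳ-≈
          (*-congˡ (*-congˡ (trans (sym (∑∑-cong N≈)) (∑∑-distrib-minus {D} _ _))))
          (Window.count W N
            (λ a b → sum-nonneg (λ k → *-nonneg (during-nonneg ℓ≤ℓ′ (toℕ k)) (*-nonneg (weight-nonneg (choice k a b)) (jump-nonneg (toℕ k)))))
            (λ a b → sum-nonneg (λ k → *-nonneg (during-nonneg ℓ≤ℓ′ (toℕ k)) (keep-nonneg (choice k a b))))
            supported
            (S-nonneg ℓ) (S-pos m)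
            -- A window may span many blocks, but the growth in its last block alone already makes
            -- the earlier scale small enough.
            (≤-trans (*-monoʳ-≤ (fromℕ-nonneg 4) (S-mono-≤ ℓ≤m)) (4S≤κS m))
            0<ε 0≤δ 0<κ ε+κ≤1 (8δ≤κεSD m) 2≤D 1≤Dε² upper lower)
          where
          ℓ′ : ℕ
          ℓ′ = suc m
          ℓ≤ℓ′ : ℓ ℕ.≤ ℓ′
          ℓ≤ℓ′ = ℕ.m≤n⇒m≤1+n ℓ≤m
          W N : Fin D → Fin D → ℝ
          W a b = sum {L} (λ k → during ℓ ℓ′ (toℕ k) * (weight (choice k a b) * jump (toℕ k)))
          N a b = sum {L} (λ k → during ℓ ℓ′ (toℕ k) * keep (choice k a b))
          during-∑ : ∀ (g : Vector ℝ L) →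
            sum {L} (λ k → before ℓ′ (toℕ k) * g k) - sum {L} (λ k → before ℓ (toℕ k) * g k)
              ≈ sum {L} (λ k → during ℓ ℓ′ (toℕ k) * g k)
          during-∑ g = trans (sym (∑-distrib-minus {L} _ _)) (sum-cong {L} (λ k →
            solve 3 (λ x y g → x :* g :- y :* g := (x :- y) :* g) refl (before ℓ′ (toℕ k)) (before ℓ (toℕ k)) (g k)))
          N≈ : ∀ a b → C ℓ′ a b - C ℓ a b ≈ N a b
          N≈ a b = during-∑ (λ k → keep (choice k a b))
          W≈ : ∀ a b → P ℓ′ a b - P ℓ a b ≈ W a b
          W≈ a b = during-∑ (λ k → weight (choice k a b) * jump (toℕ k))
          supported : ∀ a b → W a b ≈ 0# ⊎ 1# ≤ N a b
          supported a b with em {Σ[ k ∈ Fin L ] (during ℓ ℓ′ (toℕ k) ≈ 1#) × (keep (choice k a b) ≡ 1#)}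
          ... | yes (k , e , f) = inj₂ (≤-trans
            (≤-reflexive (sym (trans (*-cong e (reflexive f)) (*-identityˡ 1#))))
            (term≤sum (λ k → *-nonneg (during-nonneg ℓ≤ℓ′ (toℕ k)) (keep-nonneg (choice k a b))) k))
          ... | no none = inj₁ (sum-zero {L} vanish)
            where
            vanish : ∀ k → during ℓ ℓ′ (toℕ k) * (weight (choice k a b) * jump (toℕ k)) ≈ 0#
            vanish k with during-cases ℓ≤ℓ′ (toℕ k) | weight-or-keep (choice k a b)
            ... | inj₂ e | _      = trans (*-congʳ e) (zeroˡ _)
            ... | inj₁ _ | inj₁ w = trans (*-congˡ (trans (*-congʳ (reflexive w)) (zeroˡ _))) (zeroʳ _)
            ... | inj₁ e | inj₂ f = contradiction (k , e , f) none
          Δ≈ : ∀ y → form (λ a b → W a b * χ a b) y ≈ kept ℓ′ y - kept ℓ y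
          Δ≈ y = trans (∑∑-cong {D} (λ a b → trans (*-congʳ (*-congʳ (sym (W≈ a b))))
              (solve 4 (λ p q c z → (p :- q) :* c :* z := p :* c :* z :- q :* c :* z) refl
                (P ℓ′ a b) (P ℓ a b) (χ a b) ((y a + y b) * (y a + y b)))))
            (∑∑-distrib-minus {D} _ _)
          upper : ∀ y → form (λ a b → W a b * χ a b) y ≤
            (S ℓ′ * (1# + ε) - S ℓ * (1# - ε)) * form χ y + fromℕ 2 * δ * (y ∙ y)
          upper y = begin
            form (λ a b → W a b * χ a b) y
              ≈⟨ Δ≈ y ⟩
            kept ℓ′ y - kept ℓ y
              ≤⟨ +-mono-≤ (proj₂ (good-ℓ′ y)) (neg-mono-≤ (proj₁ (good-ℓ y))) ⟩
            (1# + ε) * (S ℓ′ * form χ y) + δ * (y ∙ y) - ((1# - ε) * (S ℓ * form χ y) - δ * (y ∙ y))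
              ≈⟨ solve 6 (λ ε T U K δ n → (:1 :+ ε) :* (T :* K) :+ δ :* n :- ((:1 :- ε) :* (U :* K) :- δ :* n) :=
                   (T :* (:1 :+ ε) :- U :* (:1 :- ε)) :* K :+ :2 :* δ :* n) refl ε (S ℓ′) (S ℓ) (form χ y) δ (y ∙ y) ⟩
            (S ℓ′ * (1# + ε) - S ℓ * (1# - ε)) * form χ y + fromℕ 2 * δ * (y ∙ y) ∎
            where open ≤-Reasoning
          lower : ∀ y → (S ℓ′ * (1# - ε) - S ℓ * (1# + ε)) * form χ y - fromℕ 2 * δ * (y ∙ y) ≤
            form (λ a b → W a b * χ a b) y
          lower y = begin
            (S ℓ′ * (1# - ε) - S ℓ * (1# + ε)) * form χ y - fromℕ 2 * δ * (y ∙ y)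
              ≈⟨ solve 6 (λ ε T U K δ n → (:1 :- ε) :* (T :* K) :- δ :* n :- ((:1 :+ ε) :* (U :* K) :+ δ :* n) :=
                   (T :* (:1 :- ε) :- U :* (:1 :+ ε)) :* K :- :2 :* δ :* n) refl ε (S ℓ′) (S ℓ) (form χ y) δ (y ∙ y) ⟨
            (1# - ε) * (S ℓ′ * form χ y) - δ * (y ∙ y) - ((1# + ε) * (S ℓ * form χ y) + δ * (y ∙ y))
              ≤⟨ +-mono-≤ (proj₁ (good-ℓ′ y)) (neg-mono-≤ (proj₂ (good-ℓ y))) ⟩
            kept ℓ′ y - kept ℓ y
              ≈⟨ Δ≈ y ⟨
            form (λ a b → W a b * χ a b) y ∎
            where open ≤-Reasoning

        -- Each success uses a window of its own: the one reaching back to the previous success.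
        successes≤total : ∀ (Success : ℕ → Set) → (∀ {ℓ} → ℓ ℕ.≤ L → Success ℓ → Good ℓ) → ∀ {ℓ} → ℓ ℕ.≤ L →
          ∃[ k ] (k ℕ.≤ ℓ) × Good k ×
            (sum {ℓ} (λ m → κ * κ * fromℕ D * 𝟙 (Success (suc (toℕ m)))) ≤ fromℕ 4480 * (ε * ε * total k))
        successes≤total Success good {zero} _ = 0 , ℕ.z≤n , good-zero , ≤-reflexive (sym (trans
          (*-congˡ (*-congˡ (sum-zero {D} (λ a → sum-zero {D} (λ b → sum-zero {L} (λ m → zeroˡ _))))))
          (solve 1 (λ e → con (+ 4480) :* (e :* :0) := :0) refl (ε * ε))))
        successes≤total Success good {suc ℓ} ℓ<L with successes≤total Success good (ℕ.<⇒≤ ℓ<L)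
        ... | k , k≤ℓ , good-k , bound with 𝟙-cases (Success (suc ℓ))
        ...   | inj₂ (_ , e) = k , ℕ.m≤n⇒m≤1+n k≤ℓ , good-k ,
          ≤-trans (≤-reflexive (trans (∑-last ℓ (λ m → κ * κ * fromℕ D * 𝟙 (Success (suc m)))) (trans (+-congˡ (trans (*-congˡ (reflexive e)) (zeroʳ _))) (+-identityʳ _)))) bound
        ...   | inj₁ (success , e) = suc ℓ , ℕ.≤-refl , good ℓ<L success , (begin
          sum {suc ℓ} (λ m → κ * κ * fromℕ D * 𝟙 (Success (suc (toℕ m))))
            ≈⟨ ∑-last ℓ (λ m → κ * κ * fromℕ D * 𝟙 (Success (suc m))) ⟩
          sum {ℓ} (λ m → κ * κ * fromℕ D * 𝟙 (Success (suc (toℕ m)))) + κ * κ * fromℕ D * 𝟙 (Success (suc ℓ))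
            ≤⟨ +-mono-≤ bound (≤-trans (≤-reflexive (trans (*-congˡ (reflexive e)) (*-identityʳ _))) (window k≤ℓ good-k (good ℓ<L success))) ⟩
          fromℕ 4480 * (ε * ε * total k) + fromℕ 4480 * (ε * ε * (total (suc ℓ) - total k))
            ≈⟨ solve 4 (λ c e x y → c :* (e :* x) :+ c :* (e :* (y :- x)) := c :* (e :* y)) refl (fromℕ 4480) (ε * ε) (total k) (total (suc ℓ)) ⟩
          fromℕ 4480 * (ε * ε * total (suc ℓ)) ∎)
          where open ≤-Reasoning

  -- Powers and logarithms

  ^-nonneg : ∀ n {x} → 0# ≤ x → 0# ≤ x ^ n
  ^-nonneg zero    0≤x = 0≤1
  ^-nonneg (suc n) 0≤x = *-nonneg 0≤x (^-nonneg n 0≤x)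

  ^-mono-≤ : ∀ n {x y} → 0# ≤ x → x ≤ y → x ^ n ≤ y ^ n
  ^-mono-≤ zero    0≤x x≤y = ≤-refl
  ^-mono-≤ (suc n) 0≤x x≤y = *-mono-≤ 0≤x (^-nonneg n (≤-trans 0≤x x≤y)) x≤y (^-mono-≤ n 0≤x x≤y)

  1≤x⇒1≤x^n : ∀ n {x} → 1# ≤ x → 1# ≤ x ^ n
  1≤x⇒1≤x^n zero    1≤x = ≤-refl
  1≤x⇒1≤x^n (suc n) {x} 1≤x = ≤-respˡ-≈ (*-identityˡ 1#)
    (*-mono-≤ 0≤1 (≤-trans 0≤1 (1≤x⇒1≤x^n n 1≤x)) 1≤x (1≤x⇒1≤x^n n 1≤x))

  1≤2 : 1# ≤ fromℕ 2
  1≤2 = ≤-by (fromℕ-nonneg 1) refl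

  0<2 : 0# < fromℕ 2
  0<2 = 0<fromℕ[1+n] 1

  2x≤x⇒x≤0 : ∀ {x} → fromℕ 2 * x ≤ x → x ≤ 0#
  2x≤x⇒x≤0 {x} h = ≤-by (x≤y⇒0≤y-x h) (solve 1 (λ x → :0 := x :+ (x :- :2 :* x)) refl x)

  -- A consequence of completeness: if the powers of 2 were bounded, their supremum s would satisfy
  -- s ≤ s/2, since doubling a power gives another power, and yet s ≥ 1.
  archimedean : ∀ z → ∃[ n ] z ≤ fromℕ 2 ^ n
  archimedean z with em {∃[ n ] z ≤ fromℕ 2 ^ n}
  ... | yes found = found
  ... | no ¬found = contradiction
    (2x≤x⇒x≤0 (≤-trans (*-monoʳ-≤ (<⇒≤ 0<2) s≤s/2) (≤-reflexive (trans (*-comm _ _) (x/y*y≈x s 0<2)))))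
    (<⇒≱ (<-≤-trans 0<1 (powers≤s 0)))
    where
    Powers : ℝ → Set
    Powers y = ∃[ n ] y ≈ fromℕ 2 ^ n
    s : ℝ
    s = sup Powers
    isSup : IsSupremum Powers s
    isSup = sup-isSupremum Powers (1# , 0 , refl)
      (z , λ (n , y≈) → ≤-trans (≤-reflexive y≈) (<⇒≤ (≰⇒> (λ z≤ → ¬found (n , z≤)))))
    powers≤s : ∀ n → fromℕ 2 ^ n ≤ s
    powers≤s n = proj₁ isSup (n , refl)
    s≤s/2 : s ≤ s / fromℕ 2
    s≤s/2 = proj₂ isSup λ (n , y≈) → *-cancelˡ-≤ 0<2 (≤-trans (*-monoʳ-≤ (<⇒≤ 0<2) (≤-reflexive y≈))
      (≤-trans (powers≤s (suc n)) (≤-reflexive (sym (trans (*-comm _ _) (x/y*y≈x s 0<2))))))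

  2^-cancel-≤ : ∀ m n → fromℕ 2 ^ m ≤ fromℕ 2 ^ n → m ℕ.≤ n
  2^-cancel-≤ zero    n       _ = ℕ.z≤n
  2^-cancel-≤ (suc m) zero    h = contradiction
    (2x≤x⇒x≤0 (≤-trans (*-monoʳ-≤ (<⇒≤ 0<2) (1≤x⇒1≤x^n m 1≤2)) h)) (<⇒≱ 0<1)
  2^-cancel-≤ (suc m) (suc n) h = ℕ.s≤s (2^-cancel-≤ m n (*-cancelˡ-≤ 0<2 h))

  -- An element (a - b)/(p + 1) of the defining set has 2^a ≤ 2^b x^(p + 1) ≤ 2^(b + N (p + 1)), and
  -- comparing exponents gives a - b ≤ N (p + 1). From 1 ≤ x the set contains 0, so its supremum is
  -- meaningful.
  log₂≤ : ∀ {x} N → 1# ≤ x → x ≤ fromℕ 2 ^ N → log₂ x ≤ fromℕ N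
  log₂≤ {x} N 1≤x x≤2^N = proj₂ (sup-isSupremum S
      ((fromℕ 0 - fromℕ 0) / fromℕ 1 , 0 , 0 , 0
        , ≤-trans 1≤x (≤-reflexive (solve 1 (λ x → x := :1 :* (x :* :1)) refl x)) , refl)
      (fromℕ N , λ {y} → bound {y})) (λ {y} → bound {y})
    where
    open ≤-Reasoning
    S : ℝ → Set
    S y = ∃[ a ] ∃[ b ] ∃[ p ] (fromℕ 2 ^ a ≤ fromℕ 2 ^ b * x ^ suc p) ×
      (y ≈ (fromℕ a - fromℕ b) / fromℕ (suc p))
    bound : IsUpperBound S (fromℕ N)
    bound {y} (a , b , p , 2^a≤ , y≈) = ≤-respˡ-≈ (sym y≈) (x≤z*y⇒x/y≤z (0<fromℕ[1+n] p) (begin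
      fromℕ a - fromℕ b
        ≤⟨ +-monoˡ-≤ _ (fromℕ-mono (2^-cancel-≤ a (b ℕ.+ N ℕ.* suc p) (begin
             fromℕ 2 ^ a
               ≤⟨ 2^a≤ ⟩
             fromℕ 2 ^ b * x ^ suc p
               ≤⟨ *-monoʳ-≤ (^-nonneg b (<⇒≤ 0<2)) (^-mono-≤ (suc p) (≤-trans 0≤1 1≤x) x≤2^N) ⟩
             fromℕ 2 ^ b * (fromℕ 2 ^ N) ^ suc p
               ≈⟨ *-congˡ (^-assocʳ (fromℕ 2) N (suc p)) ⟩
             fromℕ 2 ^ b * fromℕ 2 ^ (N ℕ.* suc p)
               ≈⟨ ^-homo-* (fromℕ 2) b (N ℕ.* suc p) ⟨
             fromℕ 2 ^ (b ℕ.+ N ℕ.* suc p) ∎))) ⟩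
      fromℕ (b ℕ.+ N ℕ.* suc p) - fromℕ b
        ≈⟨ +-congʳ (trans (×-homo-+ 1# b (N ℕ.* suc p)) (+-congˡ (×1-homo-* N (suc p)))) ⟩
      fromℕ b + fromℕ N * fromℕ (suc p) - fromℕ b
        ≈⟨ solve 2 (λ b n → b :+ n :- b := n) refl (fromℕ b) (fromℕ N * fromℕ (suc p)) ⟩
      fromℕ N * fromℕ (suc p) ∎))

  -- P + 1 becomes the number of blocks: the first bound keeps the largest scale within the budget
  -- of the norm, the second ensures that only a constant factor of the logarithm is lost. The
  -- search descends from the bound of `archimedean`.
  log-floor : ∀ g {x} → fromℕ 2 ^ suc g ≤ x → let Γ = fromℕ 2 ^ suc g in
    ∃[ P ] (Γ ^ suc P ≤ x) × (x ≤ Γ ^ suc (suc P))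
  log-floor g {x} Γ≤x = let (N , x≤2^N) = archimedean x in
    search N (≤-trans x≤2^N (≤-trans (^-mono-≤ N (<⇒≤ 0<2) 2≤Γ)
      (≤-trans (≤Γ* N) (≤Γ* (suc N)))))
    where
    Γ : ℝ
    Γ = fromℕ 2 ^ suc g
    1≤Γ : 1# ≤ Γ
    1≤Γ = 1≤x⇒1≤x^n (suc g) 1≤2
    2≤Γ : fromℕ 2 ≤ Γ
    2≤Γ = ≤-respˡ-≈ (*-identityʳ _) (*-monoʳ-≤ (<⇒≤ 0<2) (1≤x⇒1≤x^n g 1≤2))
    ≤Γ* : ∀ n → Γ ^ n ≤ Γ ^ suc n
    ≤Γ* n = ≤-respˡ-≈ (*-identityˡ _) (*-monoˡ-≤ (^-nonneg n (≤-trans 0≤1 1≤Γ)) 1≤Γ)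
    search : ∀ N → x ≤ Γ ^ suc (suc N) → ∃[ P ] (Γ ^ suc P ≤ x) × (x ≤ Γ ^ suc (suc P))
    search zero    x≤ = 0 , ≤-respˡ-≈ (sym (*-identityʳ Γ)) Γ≤x , x≤
    search (suc N) x≤ with ≤-total x (Γ ^ suc (suc N))
    ... | inj₁ x≤′ = search N x≤′
    ... | inj₂ ≤x  = suc N , ≤x , x≤

  -- The lower bound

  approximation-energy : ∀ {n m d ε δ} (A : Matrix n d) (Ã : Matrix m d) →
    IsSpectralApproximation ε δ A Ã → ∀ x →
      ((1# - ε) * energy A x - δ * (x ∙ x) ≤ energy Ã x) ×
      (energy Ã x ≤ (1# + ε) * energy A x + δ * (x ∙ x))
  approximation-energy {ε = ε} {δ} A Ã (below , above) x =
      0≤y-x⇒x≤y (≤-respʳ-≈ (trans (qf-⊖ (gram Ã) ((1# - ε) ⊙ gram A ⊖ δ ⊙ 𝐈) x) (+-cong (qf-gram Ã x) (-‿cong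
        (trans (qf-⊖ ((1# - ε) ⊙ gram A) (δ ⊙ 𝐈) x) (+-cong scaled (-‿cong shift)))))) (below x))
    , 0≤y-x⇒x≤y (≤-respʳ-≈ (trans (qf-⊖ ((1# + ε) ⊙ gram A ⊕ δ ⊙ 𝐈) (gram Ã) x) (+-cong
        (trans (qf-⊕ ((1# + ε) ⊙ gram A) (δ ⊙ 𝐈) x) (+-cong scaled shift)) (-‿cong (qf-gram Ã x)))) (above x))
    where
    scaled : ∀ {c} → qf (c ⊙ gram A) x ≈ c * energy A x
    scaled {c} = trans (qf-⊙ c (gram A) x) (*-congˡ (qf-gram A x))
    shift : qf (δ ⊙ 𝐈) x ≈ δ * (x ∙ x)
    shift = trans (qf-⊙ δ 𝐈 x) (*-congˡ (qf-𝐈 x))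

  module Bounds {κ Γ : ℝ} (0<κ : 0# < κ) (1≤Γ : 1# ≤ Γ) (32≤κΓ : fromℕ 32 ≤ κ * Γ) where

    0<Γ : 0# < Γ
    0<Γ = <-≤-trans 0<1 1≤Γ

    module ForParameters (D : ℕ) (ε δ s : ℝ) (0<ε : 0# < ε) (ε+κ≤1 : ε + κ ≤ 1#) (0<δ : 0# < δ) (0≤s : 0# ≤ s)
      (P : ℕ) (Γ^Lδ≤εs² : Γ ^ suc P * δ ≤ ε * s ^ 2) (2/√d≤ε : fromℕ 2 / √ (fromℕ (suc D)) ≤ ε) where

      open ≤-Reasoning

      0≤κ : 0# ≤ κ
      0≤κ = <⇒≤ 0<κ

      0≤ε : 0# ≤ ε
      0≤ε = <⇒≤ 0<ε

      0≤δ : 0# ≤ δ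
      0≤δ = <⇒≤ 0<δ

      ε²≤1 : ε * ε ≤ 1#
      ε²≤1 = ≤-respʳ-≈ (*-identityˡ 1#) (square-mono-≤ 0≤ε (≤-trans (≤-by 0≤κ refl) ε+κ≤1))

      -- The constant 2 in front of 1/√d, squared. It leaves room for passing from d to D = d - 1,
      -- which costs at most ε² ≤ 1, and with ε ≤ 1 it also gives d ≥ 4.
      4≤dε² : fromℕ 4 ≤ fromℕ (suc D) * (ε * ε)
      4≤dε² = begin
        fromℕ 4           ≈⟨ solve 0 (con (+ 4) := :2 :* :2) refl ⟩
        fromℕ 2 * fromℕ 2 ≤⟨ square-mono-≤ (<⇒≤ 0<2) 2≤εr ⟩
        ε * r * (ε * r)   ≈⟨ solve 2 (λ ε r → ε :* r :* (ε :* r) := r :* r :* (ε :* ε)) refl ε r ⟩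
        r * r * (ε * ε)   ≈⟨ *-congʳ (√-square (fromℕ-nonneg (suc D))) ⟩
        fromℕ (suc D) * (ε * ε) ∎
        where
        r : ℝ
        r = √ (fromℕ (suc D))
        0<r : 0# < r
        0<r = <-≤-trans 0<1 (√-upper (fromℕ-nonneg (suc D))
          (≤-by (fromℕ-nonneg D) (+-congʳ (sym (*-identityˡ 1#)))))
        2≤εr : fromℕ 2 ≤ ε * r
        2≤εr = ≤-respˡ-≈ (x/y*y≈x _ 0<r) (*-monoˡ-≤ (<⇒≤ 0<r) 2/√d≤ε)

      4≤d : fromℕ 4 ≤ fromℕ (suc D)
      4≤d = ≤-trans 4≤dε² (≤-respʳ-≈ (*-identityʳ _) (*-monoʳ-≤ (fromℕ-nonneg (suc D)) ε²≤1))

      2≤D : fromℕ 2 ≤ fromℕ D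
      2≤D = ≤-by (+-nonneg (x≤y⇒0≤y-x 4≤d) 0≤1)
        (solve 1 (λ D → D := :2 :+ (:1 :+ D :- con (+ 4) :+ :1)) refl (fromℕ D))

      0<D : 0# < fromℕ D
      0<D = <-≤-trans 0<2 2≤D

      d≤2D : fromℕ (suc D) ≤ fromℕ 2 * fromℕ D
      d≤2D = ≤-by (+-nonneg (x≤y⇒0≤y-x 2≤D) 0≤1)
        (solve 1 (λ D → :2 :* D := :1 :+ D :+ (D :- :2 :+ :1)) refl (fromℕ D))

      1≤Dε² : 1# ≤ fromℕ D * (ε * ε)
      1≤Dε² = ≤-by (+-nonneg (+-nonneg (x≤y⇒0≤y-x 4≤dε²) (x≤y⇒0≤y-x ε²≤1)) (fromℕ-nonneg 2))
        (solve 2 (λ D e → D :* e := :1 :+ ((:1 :+ D) :* e :- con (+ 4) :+ (:1 :- e) :+ :2)) refl (fromℕ D) (ε * ε))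

      s²≈ : s ^ 2 ≈ s * s
      s²≈ = *-congˡ (*-identityʳ s)

      L : ℕ
      L = suc P

      -- ρ is the smallest scale whose multiplicative error absorbs the additive error δ.
      κεD ρ : ℝ
      κεD = κ * (ε * fromℕ D)
      ρ = fromℕ 8 * δ / κεD

      0<κεD : 0# < κεD
      0<κεD = *-pos 0<κ (*-pos 0<ε 0<D)

      0<ρ : 0# < ρ
      0<ρ = *-pos (*-pos (0<fromℕ[1+n] 7) 0<δ) (⁻¹-pos 0<κεD)

      ρκεD≈8δ : ρ * κεD ≈ fromℕ 8 * δ
      ρκεD≈8δ = x/y*y≈x _ 0<κεD

      0<Γ^ : ∀ m → 0# < Γ ^ m
      0<Γ^ m = <-≤-trans 0<1 (1≤x⇒1≤x^n m 1≤Γ)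

      0<s : 0# < s
      0<s = 0≤s , λ 0≈s → <⇒≱ (*-pos (0<Γ^ L) 0<δ) (≤-trans Γ^Lδ≤εs²
        (≤-reflexive (trans (*-congˡ (trans (*-congʳ (sym 0≈s)) (zeroˡ _))) (zeroʳ ε))))

      S : ℕ → ℝ
      S zero    = 0#
      S (suc m) = ρ * Γ ^ m

      S-pos : ∀ m → 0# < S (suc m)
      S-pos m = *-pos 0<ρ (0<Γ^ m)

      S-mono : ∀ m → S m ≤ S (suc m)
      S-mono zero    = <⇒≤ (S-pos zero)
      S-mono (suc m) = *-monoʳ-≤ (<⇒≤ 0<ρ) (≤-respˡ-≈ (*-identityˡ _) (*-monoˡ-≤ (<⇒≤ (0<Γ^ m)) 1≤Γ))

      4S≤κS : ∀ m → fromℕ 4 * S m ≤ κ * S (suc m)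
      4S≤κS zero    = ≤-respˡ-≈ (sym (zeroʳ _)) (*-nonneg 0≤κ (<⇒≤ (S-pos zero)))
      4S≤κS (suc m) = begin
        fromℕ 4 * (ρ * Γ ^ m)    ≤⟨ *-monoˡ-≤ (<⇒≤ (S-pos m)) (≤-trans (fromℕ-mono (ℕ.m≤m+n 4 28)) 32≤κΓ) ⟩
        κ * Γ * (ρ * Γ ^ m)      ≈⟨ solve 4 (λ κ Γ ρ h → κ :* Γ :* (ρ :* h) := κ :* (ρ :* (Γ :* h))) refl κ Γ ρ (Γ ^ m) ⟩
        κ * (ρ * (Γ * Γ ^ m))    ∎

      8δ≤κεSD : ∀ m → fromℕ 8 * δ ≤ κ * (ε * (S (suc m) * fromℕ D))
      8δ≤κεSD m = begin
        fromℕ 8 * δ                             ≈⟨ *-identityʳ _ ⟨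
        fromℕ 8 * δ * 1#                        ≤⟨ *-monoʳ-≤ (*-nonneg (fromℕ-nonneg 8) 0≤δ) (1≤x⇒1≤x^n m 1≤Γ) ⟩
        fromℕ 8 * δ * Γ ^ m                     ≈⟨ *-congʳ ρκεD≈8δ ⟨
        ρ * (κ * (ε * fromℕ D)) * Γ ^ m         ≈⟨ solve 5 (λ κ ε D ρ h → ρ :* (κ :* (ε :* D)) :* h := κ :* (ε :* (ρ :* h :* D))) refl κ ε (fromℕ D) ρ (Γ ^ m) ⟩
        κ * (ε * (ρ * Γ ^ m * fromℕ D))         ∎

      -- The last scale is ρ Γ^P, one factor `Γ` short of Γ^L. The spare factor pays for 32/κ, where
      -- 32 = 4 · 8 combines the 4 of `form-χ≤` with the 8 in `ρ`.
      S-L : S L * (fromℕ 4 * fromℕ D) ≤ s * s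
      S-L = *-cancelˡ-≤ (*-pos 0<κ 0<ε) (begin
        κ * ε * (ρ * Γ ^ P * (fromℕ 4 * fromℕ D))
          ≈⟨ solve 5 (λ κ ε ρ h D → κ :* ε :* (ρ :* h :* (con (+ 4) :* D)) := con (+ 4) :* h :* (ρ :* (κ :* (ε :* D)))) refl κ ε ρ (Γ ^ P) (fromℕ D) ⟩
        fromℕ 4 * Γ ^ P * (ρ * κεD)
          ≈⟨ *-congˡ ρκεD≈8δ ⟩
        fromℕ 4 * Γ ^ P * (fromℕ 8 * δ)
          ≈⟨ solve 2 (λ h δ → con (+ 4) :* h :* (con (+ 8) :* δ) := con (+ 32) :* (h :* δ)) refl (Γ ^ P) δ ⟩
        fromℕ 32 * (Γ ^ P * δ)
          ≤⟨ *-monoˡ-≤ (*-nonneg (<⇒≤ (0<Γ^ P)) 0≤δ) 32≤κΓ ⟩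
        κ * Γ * (Γ ^ P * δ)
          ≈⟨ solve 4 (λ κ Γ h δ → κ :* Γ :* (h :* δ) := κ :* (Γ :* h :* δ)) refl κ Γ (Γ ^ P) δ ⟩
        κ * (Γ ^ suc P * δ)
          ≤⟨ *-monoʳ-≤ 0≤κ Γ^Lδ≤εs² ⟩
        κ * (ε * s ^ 2)
          ≈⟨ trans (sym (*-assoc _ _ _)) (*-congˡ s²≈) ⟩
        κ * ε * (s * s) ∎)

      open HardInstance D L s S refl S-mono

      -- The first row is orthogonal to the edge rows, so the norm is the larger of s and the norm
      -- of the blocks, which `S-L` keeps at most s. Every prefix therefore meets the conditions
      -- under which success is assumed.
      norm : ∀ {ℓ} → ℓ ℕ.≤ L → ∥ hard ℓ ∥₂ ≈ s
      norm {ℓ} ℓ≤L = ∥∥₂≈ (hard ℓ) 0<s bound (𝐈 zero) (𝐈-∙ {suc D} zero) attained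
        where
        bound : ∀ x → energy (hard ℓ) x ≤ s * s * (x ∙ x)
        bound x = begin
          energy (hard ℓ) x
            ≈⟨ energy-hard ℓ≤L x ⟩
          s * s * (x zero * x zero) + S ℓ * form χ (tail x)
            ≤⟨ +-mono-≤ ≤-refl (≤-trans
                 (*-monoʳ-≤ (S-nonneg ℓ) (form-χ≤ (tail x)))
                 (≤-trans (≤-reflexive (sym (*-assoc _ _ _)))
                   (*-monoˡ-≤ (sum-nonneg {D} (λ j → square-nonneg (x (suc j))))
                     (≤-trans (*-monoˡ-≤ (*-nonneg (fromℕ-nonneg 4) (<⇒≤ 0<D)) (S-mono-≤ ℓ≤L)) S-L)))) ⟩
          s * s * (x zero * x zero) + s * s * (tail x ∙ tail x)
            ≈⟨ distribˡ _ _ _ ⟨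
          s * s * (x ∙ x) ∎
          where
          S-nonneg : ∀ ℓ → 0# ≤ S ℓ
          S-nonneg zero    = ≤-refl
          S-nonneg (suc m) = <⇒≤ (S-pos m)
        attained : energy (hard ℓ) (𝐈 zero) ≈ s * s
        attained = trans (energy-hard ℓ≤L (𝐈 zero)) (trans (+-cong
            (trans (*-congˡ (*-identityˡ 1#)) (*-identityʳ _))
            (trans (*-congˡ (trans (∑∑-cong {D} (λ a b → solve 1 (λ c → c :* ((:0 :+ :0) :* (:0 :+ :0)) := :0) refl (χ a b)))
              (sum-zero {D} (λ a → sum-zero {D} (λ b → refl))))) (zeroʳ _)))
          (+-identityʳ _))

      module _ (alg : RandomizedOnlineAlgorithm (suc D)) where
        open RandomizedOnlineAlgorithm alg
        open Probability space

        rows : Ω → ℕ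
        rows ω = length (run (algorithm ω) (hard L))

        Success : Ω → ℕ → Set
        Success ω ℓ = IsSpectralApproximation ε δ (hard ℓ) (fromList (run (algorithm ω) (hard ℓ)))

        successes≤rows : ∀ ω → sum {L} (λ m → κ * κ * fromℕ D * 𝟙 (Success ω (suc (toℕ m))))
          ≤ fromℕ 4480 * (ε * ε * fromℕ (rows ω))
        successes≤rows ω =
          let (k , _ , _ , bound) = successes≤total (Success ω) good (ℕ.≤-refl {L})
          in ≤-trans bound (*-monoʳ-≤ (fromℕ-nonneg 4480) (*-monoʳ-≤ (square-nonneg ε) (total≤length k)))
          where
          open Run (algorithm ω (suc size))
          open Count 0<ε 0≤δ 0<κ ε+κ≤1 2≤D 1≤Dε² S-pos 4S≤κS 8δ≤κεSD
          good : ∀ {ℓ} → ℓ ℕ.≤ L → Success ω ℓ → Good ℓ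
          good {ℓ} ℓ≤L success y =
            let (below , above) = approximation-energy (hard ℓ) (fromList (run (algorithm ω) (hard ℓ))) success (pad y)
                A≈ = energy-hard-pad ℓ≤L y
                n≈ = *-congˡ (pad-∙ y)
            in ≤-respʳ-≈ (energy-kept ℓ y) (≤-respˡ-≈ (+-cong (*-congˡ A≈) (-‿cong n≈)) below)
             , ≤-respˡ-≈ (energy-kept ℓ y) (≤-respʳ-≈ (+-cong (*-congˡ A≈) n≈) above)

        -- Integrates the pointwise bound `successes≤rows`. The successes of different prefixes may
        -- depend on each other in any way, as only the sum of their probabilities enters.
        expected≥ : (∀ ℓ → ℓ ℕ.≤ L → SucceedsWithProbability≥½ ε δ (hard ℓ)) →
          fromℕ L * (κ * κ * fromℕ D * ½) ≤ fromℕ 4480 * (ε * ε) * expectedRows (hard L)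
        expected≥ succeeds = begin
          fromℕ L * (κ * κ * fromℕ D * ½)
            ≈⟨ sum-const L _ ⟨
          sum {L} (λ _ → κ * κ * fromℕ D * ½)
            ≤⟨ sum-mono {L} (λ m → *-monoʳ-≤ (*-nonneg (square-nonneg κ) (<⇒≤ 0<D)) (proj₂ (event m))) ⟩
          sum {L} (λ m → integral (X m))
            ≤⟨ integral-mono X Y pointwise ⟩
          sum {suc (suc size)} (λ k → integral (Y k))
            ≈⟨ sum-cong {suc (suc size)} (λ k → *-assoc (fromℕ 4480 * (ε * ε)) (fromℕ (toℕ k)) (ℙ (count-event (hard L) (toℕ k)))) ⟩
          sum {suc (suc size)} (λ k → fromℕ 4480 * (ε * ε) * (fromℕ (toℕ k) * ℙ (count-event (hard L) (toℕ k))))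
            ≈⟨ *-distribˡ-∑ {suc (suc size)} (fromℕ 4480 * (ε * ε)) (λ k → fromℕ (toℕ k) * ℙ (count-event (hard L) (toℕ k))) ⟨
          fromℕ 4480 * (ε * ε) * expectedRows (hard L) ∎
          where
          event : ∀ (m : Fin L) → SucceedsWithProbability≥½ ε δ (hard (suc (toℕ m)))
          event m = succeeds (suc (toℕ m)) (Fin.toℕ<n m)
          X : Vector Weighted L
          X m = κ * κ * fromℕ D , (λ ω → Success ω (suc (toℕ m))) , proj₁ (event m)
          -- The row counts 0 to size + 1 can occur, hence size + 2 events, indexed as in
          -- `expectedRows`.
          Y : Vector Weighted (suc (suc size))
          Y k = fromℕ 4480 * (ε * ε) * fromℕ (toℕ k) , (λ ω → rows ω ≡ toℕ k) , count-event (hard L) (toℕ k)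
          pointwise : ∀ ω → sum {L} (λ m → value ω (X m)) ≤ sum {suc (suc size)} (λ k → value ω (Y k))
          pointwise ω = begin
            sum {L} (λ m → value ω (X m))
              ≤⟨ successes≤rows ω ⟩
            fromℕ 4480 * (ε * ε * fromℕ (rows ω))
              ≈⟨ *-assoc _ _ _ ⟨
            fromℕ 4480 * (ε * ε) * fromℕ (rows ω)
              ≈⟨ trans (*-congˡ (reflexive (𝟙-true (≡.sym k≡)))) (trans (*-identityʳ _) (*-congˡ (reflexive (≡.cong fromℕ k≡)))) ⟨
            value ω (Y k)
              ≤⟨ term≤sum (λ k → *-nonneg (*-nonneg (*-nonneg (fromℕ-nonneg 4480) (square-nonneg ε)) (fromℕ-nonneg (toℕ k))) (𝟙-nonneg (rows ω ≡ toℕ k))) k ⟩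
            sum {suc (suc size)} (λ k → value ω (Y k)) ∎
            where
            k : Fin (suc (suc size))
            k = Fin.fromℕ< (ℕ.s≤s (length-keptRows≤ (algorithm ω (suc size)) [] (hard L)))
            k≡ : toℕ k ≡ rows ω
            k≡ = Fin.toℕ-fromℕ< _

  module Constants {ε₀ : ℝ} (ε₀<1 : ε₀ < 1#) where

    -- For ε ≥ 1 discarding every row is a valid approximation, so the constants must degrade as
    -- `ε₀` approaches 1; this is the distance that remains.
    κ : ℝ
    κ = 1# - ε₀

    0<κ : 0# < κ
    0<κ = x≤y⇒0≤y-x (proj₁ ε₀<1) , λ 0≈κ → proj₂ ε₀<1
      (trans (sym (+-identityʳ ε₀)) (trans (+-congˡ 0≈κ) (solve 1 (λ e → e :+ (:1 :- e) := :1) refl ε₀)))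

    -- A power of 2 for `Γ` makes the binary logarithms of its powers integers. The exponent g + 1
    -- instead of g guarantees Γ ≥ 2, so that its powers exceed every bound in `log-floor`.
    g : ℕ
    g = proj₁ (archimedean (fromℕ 32 / κ))

    Γ : ℝ
    Γ = fromℕ 2 ^ suc g

    1≤Γ : 1# ≤ Γ
    1≤Γ = 1≤x⇒1≤x^n (suc g) 1≤2

    0<Γ : 0# < Γ
    0<Γ = <-≤-trans 0<1 1≤Γ

    32≤κΓ : fromℕ 32 ≤ κ * Γ
    32≤κΓ = begin
      fromℕ 32               ≈⟨ x/y*y≈x _ 0<κ ⟨
      fromℕ 32 / κ * κ       ≤⟨ *-monoˡ-≤ (<⇒≤ 0<κ) (proj₂ (archimedean (fromℕ 32 / κ))) ⟩
      fromℕ 2 ^ g * κ        ≤⟨ *-monoˡ-≤ (<⇒≤ 0<κ) (≤-respˡ-≈ (*-identityˡ _) (*-monoˡ-≤ (^-nonneg g (<⇒≤ 0<2)) 1≤2)) ⟩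
      Γ * κ                  ≈⟨ *-comm Γ κ ⟩
      κ * Γ                  ∎
      where open ≤-Reasoning

    -- 80 · 448 = 8 · 4480. The 8 collects the probability 1/2, d ≤ 2 D and L + 1 ≤ 2 L; 4480 comes
    -- from `count`; and g + 1 is the binary logarithm of `Γ`.
    c C : ℝ
    c = fromℕ 80 * (fromℕ 448 * fromℕ (suc g))
    C = κ * κ / c

    0<c : 0# < c
    0<c = *-pos (0<fromℕ[1+n] 79) (*-pos (0<fromℕ[1+n] 447) (0<fromℕ[1+n] g))

    0<C : 0# < C
    0<C = *-pos (*-pos 0<κ 0<κ) (⁻¹-pos 0<c)

    bound : ∀ (d : ℕ) .{{_ : NonZero d}} (ε δ s : ℝ) → 0# < ε → ε ≤ ε₀ → 0# < δ → 0# ≤ s →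
      Γ * δ ≤ ε * s ^ 2 → fromℕ 2 / √ (fromℕ d) ≤ ε →
      (alg : RandomizedOnlineAlgorithm d) → let open RandomizedOnlineAlgorithm alg in
      (∀ {n} (A : Matrix n d) → Γ * δ ≤ ε * ∥ A ∥₂ ^ 2 → ∥ A ∥₂ ≤ s → SucceedsWithProbability≥½ ε δ A) →
      ∃[ n ] ∃[ A ] (∥_∥₂ {n} {d} A ≈ s) ×
        (C * (fromℕ d * log₂ (ε * ∥ A ∥₂ ^ 2 / δ) / ε ^ 2) ≤ expectedRows A)
    bound (suc D) ε δ s 0<ε ε≤ε₀ 0<δ 0≤s Γδ≤εs² 2/√d≤ε alg succeeds =
      conclude (log-floor g Γ≤x)
      where
      open ≤-Reasoning
      open RandomizedOnlineAlgorithm alg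
      x : ℝ
      x = ε * s ^ 2 / δ
      Γ≤x : Γ ≤ x
      Γ≤x = *-cancelˡ-≤ 0<δ (begin
        δ * Γ       ≈⟨ *-comm δ Γ ⟩
        Γ * δ       ≤⟨ Γδ≤εs² ⟩
        ε * s ^ 2   ≈⟨ trans (*-comm _ _) (x/y*y≈x _ 0<δ) ⟨
        δ * x       ∎)
      ε+κ≤1 : ε + κ ≤ 1#
      ε+κ≤1 = ≤-by (x≤y⇒0≤y-x ε≤ε₀) (solve 2 (λ ε ε₀ → :1 := ε :+ (:1 :- ε₀) :+ (ε₀ :- ε)) refl ε ε₀)
      0<ε² : 0# < ε ^ 2
      0<ε² = *-pos 0<ε (*-pos 0<ε 0<1)
      conclude : ∃[ P ] (Γ ^ suc P ≤ x) × (x ≤ Γ ^ suc (suc P)) →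
        ∃[ n ] ∃[ A ] (∥_∥₂ {n} {suc D} A ≈ s) ×
          (C * (fromℕ (suc D) * log₂ (ε * ∥ A ∥₂ ^ 2 / δ) / ε ^ 2) ≤ expectedRows A)
      conclude (P , Γ^L≤x , x≤) = _ , A , norm (ℕ.≤-refl {L}) , *-cancelˡ-≤ (*-pos 0<c 0<ε²) (begin
        c * ε ^ 2 * (C * (fromℕ (suc D) * ℓ / ε ^ 2))
          ≈⟨ solve 4 (λ c e C y → c :* e :* (C :* y) := C :* c :* (y :* e)) refl c (ε ^ 2) C (fromℕ (suc D) * ℓ / ε ^ 2) ⟩
        C * c * (fromℕ (suc D) * ℓ / ε ^ 2 * ε ^ 2)
          ≈⟨ *-cong (x/y*y≈x _ 0<c) (x/y*y≈x _ 0<ε²) ⟩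
        κ * κ * (fromℕ (suc D) * ℓ)
          ≤⟨ *-monoʳ-≤ (square-nonneg κ) (≤-trans
               (*-monoʳ-≤ (fromℕ-nonneg (suc D)) ℓ≤)
               (*-monoˡ-≤ (*-nonneg (fromℕ-nonneg (suc g)) (*-nonneg (<⇒≤ 0<2) (fromℕ-nonneg L))) d≤2D)) ⟩
        κ * κ * (fromℕ 2 * fromℕ D * (fromℕ (suc g) * (fromℕ 2 * fromℕ L)))
          ≈⟨ *-congʳ (*-congˡ (x/y*y≈x κ 0<2)) ⟨
        κ * (κ / fromℕ 2 * fromℕ 2) * (fromℕ 2 * fromℕ D * (fromℕ (suc g) * (fromℕ 2 * fromℕ L)))
          ≈⟨ solve 5 (λ κ h D G L → κ :* (κ :* h :* :2) :* (:2 :* D :* (G :* (:2 :* L))) :=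
               con (+ 8) :* G :* (L :* (κ :* κ :* D :* (:1 :* h)))) refl κ (fromℕ 2 ⁻¹) (fromℕ D) (fromℕ (suc g)) (fromℕ L) ⟩
        fromℕ 8 * fromℕ (suc g) * (fromℕ L * (κ * κ * fromℕ D * ½))
          ≤⟨ *-monoʳ-≤ (*-nonneg (fromℕ-nonneg 8) (fromℕ-nonneg (suc g))) (expected≥ alg λ ℓ ℓ≤L → succeeds (hard ℓ)
               (≤-respʳ-≈ (*-congˡ (^-congˡ 2 (sym (norm ℓ≤L)))) Γδ≤εs²) (≤-reflexive (norm ℓ≤L))) ⟩
        fromℕ 8 * fromℕ (suc g) * (fromℕ 4480 * (ε * ε) * expectedRows A)
          ≈⟨ solve 3 (λ G ε E → con (+ 8) :* G :* (con (+ 4480) :* (ε :* ε) :* E) :=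
               con (+ 80) :* (con (+ 448) :* G) :* (ε :* (ε :* :1)) :* E) refl (fromℕ (suc g)) ε (expectedRows A) ⟩
        c * ε ^ 2 * expectedRows A ∎)
        where
        Γ^Lδ≤εs² : Γ ^ suc P * δ ≤ ε * s ^ 2
        Γ^Lδ≤εs² = ≤-respʳ-≈ (x/y*y≈x _ 0<δ) (*-monoˡ-≤ (<⇒≤ 0<δ) Γ^L≤x)
        open Bounds.ForParameters 0<κ 1≤Γ 32≤κΓ D ε δ s 0<ε ε+κ≤1 0<δ 0≤s P Γ^Lδ≤εs² 2/√d≤ε using (L; S; S-mono; norm; expected≥; d≤2D)
        open HardInstance D L s S refl S-mono using (hard; size)
        A : Matrix (suc size) (suc D)
        A = hard L
        y ℓ : ℝ
        y = ε * ∥ A ∥₂ ^ 2 / δ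
        ℓ = log₂ y
        y≈x : y ≈ x
        y≈x = *-congʳ (*-congˡ (^-congˡ 2 (norm (ℕ.≤-refl {L}))))
        ℓ≤ : ℓ ≤ fromℕ (suc g) * (fromℕ 2 * fromℕ L)
        ℓ≤ = begin
          ℓ
            ≤⟨ log₂≤ (suc g ℕ.* suc (suc P)) (≤-trans 1≤Γ (≤-respʳ-≈ (sym y≈x) Γ≤x))
                 (≤-respˡ-≈ (sym y≈x) (≤-respʳ-≈ (^-assocʳ (fromℕ 2) (suc g) (suc (suc P))) x≤)) ⟩
          fromℕ (suc g ℕ.* suc (suc P))
            ≈⟨ ×1-homo-* (suc g) (suc (suc P)) ⟩
          fromℕ (suc g) * fromℕ (suc (suc P))
            ≤⟨ *-monoʳ-≤ (fromℕ-nonneg (suc g)) (≤-by (fromℕ-nonneg P)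
                 (solve 1 (λ P → :2 :* (:1 :+ P) := :1 :+ (:1 :+ P) :+ P) refl (fromℕ P))) ⟩
          fromℕ (suc g) * (fromℕ 2 * fromℕ L) ∎

theorem5p1 : ExcludedMiddle 0ℓ → (𝓡 : Reals) → let open Analysis 𝓡 in
    ∀ (ε₀ : ℝ) → ε₀ < 1# →
    ∃[ c₁ ] ∃[ c₂ ] ∃[ C ] (0# < c₁) × (0# < c₂) × (0# < C) ×
    (∀ (d : ℕ) .{{_ : NonZero d}} (ε δ s : ℝ) → 0# < ε → ε ≤ ε₀ → 0# < δ → 0# ≤ s →
    c₁ * δ ≤ ε * s ^ 2 →
    c₂ / √ (fromℕ d) ≤ ε →
    (alg : RandomizedOnlineAlgorithm d) → let open RandomizedOnlineAlgorithm alg in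
    (∀ {n} (A : Matrix n d) → c₁ * δ ≤ ε * ∥ A ∥₂ ^ 2 → ∥ A ∥₂ ≤ s →
    SucceedsWithProbability≥½ ε δ A) →
    ∃[ n ] ∃[ A ] (∥_∥₂ {n} {d} A ≈ s) ×
    (C * (fromℕ d * log₂ (ε * ∥ A ∥₂ ^ 2 / δ) / ε ^ 2) ≤ expectedRows A))
theorem5p1 em 𝓡 ε₀ ε₀<1 = Γ , fromℕ 2 , C , 0<Γ , 0<2 , 0<C , bound
  where
  open Analysis 𝓡
  open LowerBound em 𝓡
  open Constants ε₀<1
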